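{- Let $\sigma=(a_1,\ldots,a_s)$ be an $r$-good partition of $r$ and let $H=H(n,r,q\mid\sigma)$. Let $A,B$ be disjoint sets with $A\cup B=\{1,\ldots,s\}$ such that, with $a=\sum_{j\in A}a_j$ and $b=\sum_{j\in B}a_j$, one has $\gcd(a,b)=\gcd(a,r)=\gcd(b,r)=1$, and let $L=\mathrm{lcm}(a,b)$. Then: (1) If either ($r\mid q$ and $n\ge s$) or ($r\mid n$ and $q\ge (L-1)(r-1)$), then $H$ has a perfect matching, i.e. $\nu(H)=\frac{qn}{r}$. (2) If $q\ge L(r-1)$ and $n\ge s$, then $H$ has a matching leaving at most $L(r-1)^2$ vertices unmatched; that is, $\nu(H)\ge \frac{qn-L(r-1)^2}{r}$. (3) If $q\ge L(r^2-1)$, $s\ge 3$ and $n\ge s+r$, then $H$ has a matching leaving at most $(r-1)^2$ vertices unmatched; that is, $\nu(H)\ge\frac{qn-(r-1)^2}{r}$.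
   Context: A $\sigma$-hypergraph $H=H(n,r,q\mid\sigma)$, for a partition $\sigma=(a_1,\ldots,a_s)$ of $r$ with $s=s(\sigma)$ parts, is the $r$-uniform hypergraph whose vertex set is the disjoint union of $n$ classes $V_1,\ldots,V_n$, each of size $q$; an $r$-subset $K$ of vertices is an edge iff the multiset of non-zero values $|K\cap V_i|$ ($1\le i\le n$) equals $\sigma$. The partition $\sigma$ is $r$-good if there is a subsequence $\pi$ of $(a_1,\ldots,a_s)$ (a selection of some of the parts, by index) such that $\sum_{a_j\in\pi}a_j$ is coprime to $r$. A matching is a set of pairwise vertex-disjoint edges; it is perfect if it covers every vertex; $\nu(H)$ is the maximum size of a matching. -}

module Defs where

open import Data.Bool using (if_then_else_)
open import Data.Fin using (Fin; quotient)
import Data.Fin as Fin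
open import Data.Fin.Subset using (Subset; _∈_; _∩_; ∁; ⋃; ∣_∣; Empty)
open import Data.List using (List; length; map; filter; allFin)
open import Data.List.Relation.Binary.Permutation.Propositional using (_↭_)
open import Data.List.Relation.Unary.All using (All)
open import Data.List.Relation.Unary.AllPairs using (AllPairs)
open import Data.List.Relation.Unary.Any using (Any)
open import Data.List.Relation.Unary.Unique.Propositional using (Unique)
open import Data.Nat using (ℕ; _*_; _≤_; _<_; _≟_)
open import Data.Nat.Coprimality using (Coprime)
open import Data.Product using (∃-syntax; _×_)
open import Data.Vec using (Vec; sum; tabulate; toList; zipWith)
import Data.Vec.Relation.Unary.All as Vec
open import Relation.Binary.PropositionalEquality using (_≡_)
open import Relation.Nullary using (does; ¬?)

record Hypergraph : Set₁ where
  field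
    order : ℕ
    Edge  : Subset order → Set

open Hypergraph public

-- The list M stands for the set of its members; Unique makes length M the
-- cardinality of that set.
record IsMatching (H : Hypergraph) (M : List (Subset (order H))) : Set where
  field
    edges    : All (Edge H) M
    distinct : Unique M
    disjoint : AllPairs (λ e f → Empty (e ∩ f)) M

IsPerfectMatching : (H : Hypergraph) → List (Subset (order H)) → Set
IsPerfectMatching H M = IsMatching H M × (∀ v → Any (v ∈_) M)

HasPerfectMatching : Hypergraph → Set
HasPerfectMatching H = ∃[ M ] IsPerfectMatching H M

HasMatchingLeavingAtMost : Hypergraph → ℕ → Set
HasMatchingLeavingAtMost H k = ∃[ M ] (IsMatching H M × ∣ ∁ (⋃ M) ∣ ≤ k)

-- The relation "ν(H) = k".
IsMatchingNumber : Hypergraph → ℕ → Set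
IsMatchingNumber H k =
  (∃[ M ] (IsMatching H M × length M ≡ k)) ×
  (∀ M → IsMatching H M → length M ≤ k)

-- The parts may be listed in any order.
IsPartitionOf : ℕ → ∀ {s} → Vec ℕ s → Set
IsPartitionOf r σ = Vec.All (0 <_) σ × sum σ ≡ r

sumOver : ∀ {s} → Subset s → Vec ℕ s → ℕ
sumOver J σ = sum (zipWith (λ j∈J a → if j∈J then a else 0) J σ)

Good : ℕ → ∀ {s} → Vec ℕ s → Set
Good r {s} σ = ∃[ π ] Coprime (sumOver {s} π σ) r

-- The vertex set Fin (n * q) is identified with Fin n × Fin q through
-- Data.Fin.remQuot; V i is {i} × Fin q.
V : ∀ n q → Fin n → Subset (n * q)
V n q i = tabulate (λ v → does (quotient {n} q v Fin.≟ i))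

σ-hypergraph : (n r q : ℕ) → ∀ {s} → Vec ℕ s → Hypergraph
σ-hypergraph n r q σ = record
  { order = n * q
  ; Edge  = λ K → ∣ K ∣ ≡ r ×
      filter (λ k → ¬? (k ≟ 0)) (map (λ i → ∣ K ∩ V n q i ∣) (allFin n)) ↭ toList σ
  }

{-# OPTIONS --safe #-}

-- Put each part of σ into a class, allowing several parts of one edge to share a class.
-- By König's edge colouring theorem (proved by repeatedly balancing two edges along
-- Euler orientations), a list of such degenerate edges that uses every class at most as
-- often as the list is long can be rearranged into proper edges, without changing the number
-- of vertices used in any class. Hence it suffices to find numbers X i, Y i with equal
-- sums such that a X i + b Y i is the number of vertices to be covered in class i: put
-- X i times all parts in A, and Y i times all parts in B, into class i. As a, b and
-- r = a + b are pairwise coprime, c = a X + b Y is solvable with X - Y in {d , d - r} for a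
-- d in [0 , r) once c ≥ (L - 1)(r - 1), and the choice between the two values balances the
-- sums whenever the total is divisible by r. For n ≥ r this leaves only (n q) mod r
-- vertices unmatched; for n < r the choice X = Y = ⌊ q / r ⌋ is good enough.

module Submission where

open import Defs
open import Data.Bool using (if_then_else_)
import Data.Bool as Bool
open import Data.Fin using (Fin; zero; suc; _↑ˡ_; _↑ʳ_; quotient)
import Data.Fin as Fin
open import Data.Fin.Properties using (¬∀⟶∃¬; splitAt-↑ˡ; splitAt-↑ʳ; all?)
open import Data.Fin.Subset using (Subset; _∈_; _∩_; _∪_; ∁; ⋃; ⊤; ⊥; ∣_∣; Empty; inside; outside)
open import Data.Fin.Subset.Properties using (∩-identityʳ; ∩-zeroʳ; ∩-idem; ∣⊥∣≡0; ∉⊥; ∣p∣≤n; ∣∁p∣≡n∸∣p∣; ∣p∣≡n⇒p≡⊤; ∈⊤; x∈p∩q⁺; x∈p∩q⁻; x∈p∪q⁻; Empty-unique; drop-∷-Empty; nonempty?; anySubset?)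
open import Data.List using (List; []; _∷_; length; filter; map; zipWith)
import Data.List as List
open import Data.List.Properties using (length-++; length-map; length-replicate; map-++; length-zipWith; map-tabulate) renaming (tabulate-cong to List-tabulate-cong)
open import Data.List.Relation.Binary.Permutation.Propositional using (_↭_; ↭-refl; ↭-sym; ↭-trans; ↭-reflexive; prep; swap)
open import Data.List.Relation.Binary.Permutation.Propositional.Properties using (∈-resp-↭; ¬x∷xs↭[]; drop-∷; ↭-length; map⁺)
open import Data.List.Relation.Unary.All using (All; []; _∷_)
import Data.List.Relation.Unary.All as All
open import Data.List.Relation.Unary.All.Properties using (¬All⇒Any¬; All¬⇒¬Any)
open import Data.List.Relation.Unary.AllPairs using (AllPairs; []; _∷_; allPairs?)
open import Data.List.Relation.Unary.Any using (Any; here; there; any?)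
open import Data.List.Relation.Unary.Unique.Propositional using (Unique)
open import Data.Nat using (ℕ; zero; suc; _+_; _*_; _∸_; _^_; _⊓_; _≤_; _<_; _≥_; z≤n; s≤s; s≤s⁻¹; _≟_; _≤?_; _<?_; NonZero; >-nonZero; >-nonZero⁻¹; ≢-nonZero)
open import Data.Nat.Coprimality using (Coprime; coprime-Bézout; coprime-divisor; gcd≡1⇒coprime; 0-coprimeTo-m⇒m≡1)
import Data.Nat.Coprimality as Coprimality
open import Data.Nat.Divisibility using (_∣_; divides; ∣m+n∣m⇒∣n; n∣m*n; m∣m*n; ∣⇒≤; ∣m⇒∣m*n; n∣m⇒m%n≡0)
open import Data.Nat.DivMod using (_/_; _%_; m≡m%n+[m/n]*n; m%n<n; m*n/n≡m; /-monoˡ-≤)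
open import Data.Nat.GCD using (gcd; module Bézout)
open import Data.Nat.LCM using (lcm; gcd*lcm)
open import Data.Nat.ListAction using () renaming (sum to listSum)
open import Data.Nat.ListAction.Properties using (sum-++; sum-↭)
open import Data.Nat.Properties hiding (_≟_; _≤?_; _<?_)
open import Data.Nat.Tactic.RingSolver using (solve-∀)
open import Data.Product using (∃-syntax; _×_; _,_; proj₁; proj₂)
open import Data.Sum using (_⊎_; inj₁; inj₂; [_,_]′)
open import Data.Vec using (Vec; []; _∷_; replicate; _++_; tabulate; toList)
import Data.Vec as Vec
open import Data.Vec.Properties using (zipWith-++; tabulate-cong; ∷-injectiveˡ; ∷-injectiveʳ; ≡-dec)
open import Data.Vec.Relation.Unary.All using ([]; _∷_)
import Data.Vec.Relation.Unary.All as VecAll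
open import Function using (_∘_)
open import Relation.Binary.PropositionalEquality using (_≡_; _≢_; refl; sym; trans; cong; cong₂; subst; subst₂; module ≡-Reasoning)
open import Relation.Nullary using (does; yes; no; contradiction; ¬_; ¬?; Dec; _×-dec_)
open import Relation.Nullary.Decidable using (dec-true; map′)
open import Relation.Unary using (Decidable)
open import Algebra.Properties.CommutativeMonoid.Sum +-0-commutativeMonoid using (sum; ∑-distrib-+; sum-cong-≗; sum-replicate-zero)

private variable
  n s : ℕ

-- Preliminaries on sums and on lists up to permutation

sum-mono-≤ : ∀ {f g : Fin n → ℕ} → (∀ i → f i ≤ g i) → sum f ≤ sum g
sum-mono-≤ {zero}  f≤g = z≤n
sum-mono-≤ {suc n} f≤g = +-mono-≤ (f≤g zero) (sum-mono-≤ (f≤g ∘ suc))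

sum-mono-< : ∀ {f g : Fin n → ℕ} → (∀ i → f i ≤ g i) → ∀ j → f j < g j → sum f < sum g
sum-mono-< f≤g zero    fj<gj = +-mono-<-≤ fj<gj (sum-mono-≤ (f≤g ∘ suc))
sum-mono-< f≤g (suc j) fj<gj = +-mono-≤-< (f≤g zero) (sum-mono-< (f≤g ∘ suc) j fj<gj)

pick : ∀ {A : Set} {P : A → Set} {xs} → Any P xs → ∃[ x ] ∃[ ys ] (P x × xs ↭ x ∷ ys)
pick {xs = x ∷ xs} (here px) = x , xs , px , ↭-refl
pick {xs = y ∷ xs} (there pxs) with pick pxs
... | x , ys , px , xs↭ = x , y ∷ ys , px , ↭-trans (prep y xs↭) (swap y x ↭-refl)

-- A vector E : Vec (Fin n) s puts the j-th part of σ into the class E j. Several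
-- parts may share a class; E comes from an edge of the σ-hypergraph iff it is simple.

δ : Fin n → Fin n → ℕ → ℕ
δ e i a = if does (e Fin.≟ i) then a else 0

load : Vec ℕ s → Vec (Fin n) s → Fin n → ℕ
load []      []      i = 0
load (a ∷ σ) (e ∷ E) i = δ e i a + load σ E i

-- Multiplicities are loads for unit parts, so that whatever preserves loads for every `σ` preserves
-- them too.
mult : Vec (Fin n) s → Fin n → ℕ
mult = load (replicate _ 1)

Simple : Vec (Fin n) s → Set
Simple E = ∀ i → mult E i ≤ 1

total : Vec ℕ s → List (Vec (Fin n) s) → Fin n → ℕ
total σ Es i = listSum (map (λ E → load σ E i) Es)

-- Balancing two placements along an Euler orientation

-- Classes are exchanged only within one position, so each part keeps its index and joint loads are
-- preserved for all `σ` at once.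
data Swaps {n} : ∀ {s} (E F E′ F′ : Vec (Fin n) s) → Set where
  []   : Swaps [] [] [] []
  keep : ∀ {s} {E F E′ F′ : Vec (Fin n) s} {e f} →
         Swaps E F E′ F′ → Swaps (e ∷ E) (f ∷ F) (e ∷ E′) (f ∷ F′)
  swap : ∀ {s} {E F E′ F′ : Vec (Fin n) s} {e f} →
         Swaps E F E′ F′ → Swaps (e ∷ E) (f ∷ F) (f ∷ E′) (e ∷ F′)

Swaps-load : {E F E′ F′ : Vec (Fin n) s} → Swaps E F E′ F′ →
  ∀ σ i → load σ E′ i + load σ F′ i ≡ load σ E i + load σ F i
Swaps-load [] [] i = refl
Swaps-load (keep {E = E} {F} {E′} {F′} {e} {f} p) (a ∷ σ) i = trans
  (interchange (δ e i a) (δ f i a) (load σ E′ i) (load σ F′ i)) (trans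
  (cong (δ e i a + δ f i a +_) (Swaps-load p σ i))
  (sym (interchange (δ e i a) (δ f i a) (load σ E i) (load σ F i))))
  where
  interchange : ∀ x y u v → (x + u) + (y + v) ≡ (x + y) + (u + v)
  interchange = solve-∀
Swaps-load (swap {E = E} {F} {E′} {F′} {e} {f} p) (a ∷ σ) i = trans
  (interchange (δ e i a) (δ f i a) (load σ E′ i) (load σ F′ i)) (trans
  (cong (δ e i a + δ f i a +_) (Swaps-load p σ i))
  (sym (interchange′ (δ e i a) (δ f i a) (load σ E i) (load σ F i))))
  where
  interchange : ∀ x y u v → (y + u) + (x + v) ≡ (x + y) + (u + v)
  interchange = solve-∀
  interchange′ : ∀ x y u v → (x + u) + (y + v) ≡ (x + y) + (u + v)
  interchange′ = solve-∀

-- Orient each position from its class in `E` to its class in `F`: then out-degree and in-degree of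
-- every class differ by at most one, as in an Euler orientation.
record Balanced {n s} (E F : Vec (Fin n) s) : Set where
  constructor mkBalanced
  field balanced : ∀ i → mult E i ≤ suc (mult F i) × mult F i ≤ suc (mult E i)

record Same {n s} (E E′ : Vec (Fin n) s) : Set where
  constructor mkSame
  field same : ∀ i → mult E i ≡ mult E′ i

-- One part goes from `u` to `v`; adding on both sides avoids subtraction.
record Moved {n s} (u v : Fin n) (E E′ : Vec (Fin n) s) : Set where
  constructor mkMoved
  field moved : ∀ i → mult E′ i + δ u i 1 ≡ mult E i + δ v i 1

Same-refl : {E : Vec (Fin n) s} → Same E E
Same-refl = mkSame λ _ → refl

Same-∷ : ∀ e {E E′ : Vec (Fin n) s} → Same E E′ → Same (e ∷ E) (e ∷ E′)
Same-∷ e (mkSame same) = mkSame λ i → cong (δ e i 1 +_) (same i)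

Moved-∷ : ∀ e {u v} {E E′ : Vec (Fin n) s} → Moved u v E E′ → Moved u v (e ∷ E) (e ∷ E′)
Moved-∷ e {u} {v} {E} {E′} (mkMoved moved) = mkMoved λ i →
  trans (+-assoc (δ e i 1) (mult E′ i) (δ u i 1))
    (trans (cong (δ e i 1 +_) (moved i)) (sym (+-assoc (δ e i 1) (mult E i) (δ v i 1))))

Moved-head : ∀ u v (E : Vec (Fin n) s) → Moved u v (u ∷ E) (v ∷ E)
Moved-head u v E = mkMoved λ i → shuffle (δ v i 1) (mult E i) (δ u i 1)
  where
  shuffle : ∀ x m y → (x + m) + y ≡ (y + m) + x
  shuffle = solve-∀

-- Regard position j as a graph edge joining the classes E j and F j. Incident v E F
-- says that some edge has the end v; C u and D u redirect that end to u.
record Incident {n s} (v : Fin n) (E F : Vec (Fin n) s) : Set where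
  field
    C D     : Fin n → Vec (Fin n) s
    restore : ∀ u {E′ F′} → Swaps (C u) (D u) E′ F′ →
      ∃[ E″ ] ∃[ F″ ] (Swaps E F E″ F″ ×
        ((Moved u v E′ E″ × Same F′ F″) ⊎ (Same E′ E″ × Moved u v F′ F″)))

open Incident

-- The first position with an end in `v` is redirected. Keeping or swapping it decides on which side
-- the redirected end lands, and only that side changes when `v` is put back.
incident? : ∀ v (E F : Vec (Fin n) s) → Incident v E F ⊎ (mult E v ≡ 0 × mult F v ≡ 0)
incident? v []      []      = inj₂ (refl , refl)
incident? v (e ∷ E) (f ∷ F) with e Fin.≟ v
... | yes refl = inj₁ record
  { C = _∷ E
  ; D = λ _ → f ∷ F
  ; restore = λ where
      u (keep {E′ = E′} p) → _ , _ , keep p , inj₁ (Moved-head u v E′ , Same-refl)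
      u (swap {F′ = F′} p) → _ , _ , swap p , inj₂ (Same-refl , Moved-head u v F′)
  }
... | no _ with f Fin.≟ v
... | yes refl = inj₁ record
  { C = λ _ → e ∷ E
  ; D = _∷ F
  ; restore = λ where
      u (keep {F′ = F′} p) → _ , _ , keep p , inj₂ (Same-refl , Moved-head u v F′)
      u (swap {E′ = E′} p) → _ , _ , swap p , inj₁ (Moved-head u v E′ , Same-refl)
  }
... | no _ with incident? v E F
... | inj₂ isolated = inj₂ isolated
... | inj₁ incident = inj₁ record
  { C = λ u → e ∷ C incident u
  ; D = λ u → f ∷ D incident u
  ; restore = restore-∷
  }
  where
  restore-∷ : ∀ u {E′ F′} → Swaps (e ∷ C incident u) (f ∷ D incident u) E′ F′ →
    ∃[ E″ ] ∃[ F″ ] (Swaps (e ∷ E) (f ∷ F) E″ F″ ×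
      ((Moved u v E′ E″ × Same F′ F″) ⊎ (Same E′ E″ × Moved u v F′ F″)))
  restore-∷ u (keep p) with restore incident u p
  ... | _ , _ , p″ , inj₁ (moved , same) = _ , _ , keep p″ , inj₁ (Moved-∷ e moved , Same-∷ f same)
  ... | _ , _ , p″ , inj₂ (same , moved) = _ , _ , keep p″ , inj₂ (Same-∷ e same , Moved-∷ f moved)
  restore-∷ u (swap p) with restore incident u p
  ... | _ , _ , p″ , inj₁ (moved , same) = _ , _ , swap p″ , inj₁ (Moved-∷ f moved , Same-∷ e same)
  ... | _ , _ , p″ , inj₂ (same , moved) = _ , _ , swap p″ , inj₂ (Same-∷ f same , Moved-∷ e moved)

balanced-shift : ∀ {n s t} {E F : Vec (Fin n) s} {E′ F′ : Vec (Fin n) t} (k : Fin n → ℕ) →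
  (∀ i → mult E′ i ≡ mult E i + k i) → (∀ i → mult F′ i ≡ mult F i + k i) →
  Balanced E F → Balanced E′ F′
balanced-shift k eqE eqF (mkBalanced balanced) = mkBalanced λ i →
  subst₂ (λ x y → x ≤ suc y × y ≤ suc x) (sym (eqE i)) (sym (eqF i))
    (+-monoˡ-≤ (k i) (proj₁ (balanced i)) , +-monoˡ-≤ (k i) (proj₂ (balanced i)))

-- Contracting the path u - v - w to u - w: an orientation of the contracted graph lifts,
-- and adds one to both degrees of v.
contract : ∀ {u v} {E F : Vec (Fin n) s} (I : Incident v E F) {E′ F′} →
  Swaps (C I u) (D I u) E′ F′ → Balanced E′ F′ →
  ∃[ E″ ] ∃[ F″ ] (Swaps E F E″ F″ × (Balanced (u ∷ E″) (v ∷ F″) ⊎ Balanced (v ∷ E″) (u ∷ F″)))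
contract {u = u} {v} I p balanced with restore I u p
... | E″ , F″ , p″ , inj₁ (mkMoved moved , mkSame same) = E″ , F″ , p″ , inj₁ (balanced-shift (λ i → δ v i 1)
  (λ i → trans (+-comm (δ u i 1) (mult E″ i)) (moved i))
  (λ i → trans (+-comm (δ v i 1) (mult F″ i)) (cong (_+ δ v i 1) (sym (same i)))) balanced)
... | E″ , F″ , p″ , inj₂ (mkSame same , mkMoved moved) = E″ , F″ , p″ , inj₂ (balanced-shift (λ i → δ v i 1)
  (λ i → trans (+-comm (δ v i 1) (mult E″ i)) (cong (_+ δ v i 1) (sym (same i))))
  (λ i → trans (+-comm (δ u i 1) (mult F″ i)) (moved i)) balanced)

-- Induction on the number of positions: the first edge is contracted with another edge at one of
-- its ends. If there is none at either end, its orientation does not matter.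
balance : ∀ (E F : Vec (Fin n) s) → ∃[ E′ ] ∃[ F′ ] (Swaps E F E′ F′ × Balanced E′ F′)
balance [] [] = [] , [] , [] , mkBalanced λ i → z≤n , z≤n
balance (u ∷ E) (v ∷ F) with incident? v E F
... | inj₁ I with balance (C I u) (D I u)
...   | _ , _ , p , balanced with contract I p balanced
...     | _ , _ , p″ , inj₁ balanced″ = _ , _ , keep p″ , balanced″
...     | _ , _ , p″ , inj₂ balanced″ = _ , _ , swap p″ , balanced″
balance (u ∷ E) (v ∷ F) | inj₂ (Ev , Fv) with incident? u E F
-- The contracted path is now v - u - w, so the two ends come out in the opposite order and `inj₁`
-- calls for a swap.
... | inj₁ I with balance (C I v) (D I v)
...   | _ , _ , p , balanced with contract I p balanced
...     | _ , _ , p″ , inj₁ balanced″ = _ , _ , swap p″ , balanced″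
...     | _ , _ , p″ , inj₂ balanced″ = _ , _ , keep p″ , balanced″
balance (u ∷ E) (v ∷ F) | inj₂ (Ev , Fv) | inj₂ (Eu , Fu) with balance E F
... | E′ , F′ , p , mkBalanced balanced = u ∷ E′ , v ∷ F′ , keep p , mkBalanced balanced-∷
  where
  isolated : ∀ {w} → mult E w ≡ 0 → mult F w ≡ 0 → mult E′ w ≡ 0 × mult F′ w ≡ 0
  isolated {w} Ew Fw = m+n≡0⇒m≡0 _ sum≡0 , m+n≡0⇒n≡0 _ sum≡0
    where
    sum≡0 : mult E′ w + mult F′ w ≡ 0
    sum≡0 = trans (Swaps-load p (replicate _ 1) w) (cong₂ _+_ Ew Fw)
  alone : ∀ {x y z} → x ≤ 1 → y ≡ 0 → x + y ≤ suc z
  alone {x} x≤1 refl = ≤-trans (≤-reflexive (+-identityʳ x)) (≤-trans x≤1 (s≤s z≤n))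
  balanced-∷ : ∀ i → mult (u ∷ E′) i ≤ suc (mult (v ∷ F′) i) × mult (v ∷ F′) i ≤ suc (mult (u ∷ E′) i)
  -- At `u` and `v` no other position contributes, so both multiplicities are at most one there.
  balanced-∷ i with u Fin.≟ i | v Fin.≟ i
  ... | yes refl | v≟i with isolated Eu Fu
  ...   | E′u , F′u = alone ≤-refl E′u , alone (δ≤1 v≟i) F′u
    where
    δ≤1 : ∀ {P : Set} (d : Dec P) → (if does d then 1 else 0) ≤ 1
    δ≤1 (yes _) = ≤-refl
    δ≤1 (no  _) = z≤n
  balanced-∷ i | no _ | yes refl with isolated Ev Fv
  ... | E′v , F′v = alone z≤n E′v , alone ≤-refl F′v
  balanced-∷ i | no _ | no _ = balanced i

-- Making all placements simple

-- Measures the distance from simplicity: it vanishes exactly on simple placements.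
excess : Vec (Fin n) s → ℕ
excess E = sum (λ i → mult E i ∸ 1)

-- By least-excess, no pair with the sum x + y has a smaller excess than a balanced one.
balanced-excess : ∀ x y → x ≤ suc y → y ≤ suc x → (x ∸ 1) + (y ∸ 1) ≡ (x + y) ∸ 2
balanced-excess zero zero                  _ _ = refl
balanced-excess zero (suc zero)            _ _ = refl
balanced-excess zero (suc (suc y))         _ (s≤s ())
balanced-excess (suc zero)    zero         _ _ = refl
balanced-excess (suc (suc x)) zero         (s≤s ()) _
balanced-excess (suc x) (suc y)            _ _ rewrite +-suc x y = refl

least-excess : ∀ x y → (x + y) ∸ 2 ≤ (x ∸ 1) + (y ∸ 1)
least-excess zero    zero    = z≤n
least-excess zero    (suc y) = m∸n≤m y 1
least-excess (suc x) zero    rewrite +-identityʳ x = m∸n≤m x 1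
least-excess (suc x) (suc y) rewrite +-suc x y = ≤-refl

-- A balanced pair attains the least excess in every class. In class `i` the old pair has
-- multiplicities x ≥ 2 and 0, with excess x - 1, while balancing leaves x - 2.
excess-decreases : ∀ {E F E′ F′ : Vec (Fin n) s} → Swaps E F E′ F′ → Balanced E′ F′ →
  ∀ i → ¬ mult E i ≤ 1 → mult F i ≡ 0 → excess E′ + excess F′ < excess E + excess F
excess-decreases {n = n} {E = E} {F} {E′} {F′} p (mkBalanced balanced) i Ei≰1 Fi≡0 =
  subst₂ _<_ (∑-distrib-+ (λ j → mult E′ j ∸ 1) _) (∑-distrib-+ (λ j → mult E j ∸ 1) _)
    (sum-mono-< (λ j → ≤-trans (≤-reflexive (eq j)) (least-excess (mult E j) (mult F j))) i strict)
  where
  eq : ∀ j → (mult E′ j ∸ 1) + (mult F′ j ∸ 1) ≡ (mult E j + mult F j) ∸ 2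
  eq j = trans (balanced-excess _ _ (proj₁ (balanced j)) (proj₂ (balanced j)))
               (cong (_∸ 2) (Swaps-load p (replicate _ 1) j))
  drop : ∀ x → ¬ x ≤ 1 → (x + 0) ∸ 2 < (x ∸ 1) + 0
  drop zero          x≰1 = contradiction z≤n x≰1
  drop (suc zero)    x≰1 = contradiction ≤-refl x≰1
  drop (suc (suc x)) x≰1 = ≤-refl
  strict : (mult E′ i ∸ 1) + (mult F′ i ∸ 1) < (mult E i ∸ 1) + (mult F i ∸ 1)
  strict = subst₂ _<_ (sym (trans (eq i) (cong (λ y → (mult E i + y) ∸ 2) Fi≡0)))
    (cong (λ y → (mult E i ∸ 1) + (y ∸ 1)) (sym Fi≡0)) (drop (mult E i) Ei≰1)

-- Pigeonhole: if every member used `i`, the total would reach the length.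
missing : ∀ (Es : List (Vec (Fin n) s)) {i} → total (replicate _ 1) Es i < length Es →
  Any (λ E → mult E i ≡ 0) Es
missing (E ∷ Es) {i} total< with mult E i in eq
... | zero  = here eq
... | suc k = there (missing Es (≤-<-trans (m≤n+m _ k) (s≤s⁻¹ total<)))

total-↭ : ∀ (f : Vec (Fin n) s → ℕ) {Es Fs} → Es ↭ Fs → listSum (map f Es) ≡ listSum (map f Fs)
total-↭ f p = sum-↭ (map⁺ f p)

Simple? : ∀ (E : Vec (Fin n) s) → Dec (Simple E)
Simple? E = all? (λ i → mult E i ≤? 1)

-- Consider the bipartite multigraph joining each position j to the class `E j`, once for every `E`,
-- with the placements as colours. `Few` bounds the degrees of the classes by the number of colours;
-- simplicity of all placements means a proper colouring.
Few : List (Vec (Fin n) s) → Set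
Few Es = ∀ i → total (replicate _ 1) Es i ≤ length Es

-- All `σ` are needed: unit parts carry `Few` along, the actual parts the number of vertices used in
-- each class.
record Rearranged {n s} (Es Fs : List (Vec (Fin n) s)) : Set where
  field
    length≡ : length Fs ≡ length Es
    total≡  : ∀ σ i → total σ Fs i ≡ total σ Es i

open Rearranged

Few-resp : ∀ {Es Fs : List (Vec (Fin n) s)} → Rearranged Es Fs → Few Es → Few Fs
Few-resp {s = s} p few i = subst₂ _≤_ (sym (total≡ p (replicate s 1) i)) (sym (length≡ p)) (few i)

totalExcess : List (Vec (Fin n) s) → ℕ
totalExcess Es = listSum (map excess Es)

rebalance : ∀ {Es Rs} {E F : Vec (Fin n) s} → Es ↭ E ∷ F ∷ Rs → ∀ {i} → ¬ mult E i ≤ 1 → mult F i ≡ 0 →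
  ∃[ Fs ] (Rearranged Es Fs × totalExcess Fs < totalExcess Es)
rebalance {Es = Es} {Rs} {E} {F} Es↭ {i} Ei≰1 Fi≡0 with balance E F
... | E′ , F′ , p , balanced = E′ ∷ F′ ∷ Rs , record { length≡ = sym (↭-length Es↭) ; total≡ = total-eq } , decreased
  where
  open ≤-Reasoning
  total-eq : ∀ σ i → total σ (E′ ∷ F′ ∷ Rs) i ≡ total σ Es i
  total-eq σ i = begin-equality
    load σ E′ i + (load σ F′ i + rest)  ≡⟨ +-assoc (load σ E′ i) (load σ F′ i) rest ⟨
    load σ E′ i + load σ F′ i + rest    ≡⟨ cong (_+ rest) (Swaps-load p σ i) ⟩
    load σ E i + load σ F i + rest      ≡⟨ +-assoc (load σ E i) (load σ F i) rest ⟩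
    load σ E i + (load σ F i + rest)    ≡⟨ total-↭ (λ E → load σ E i) Es↭ ⟨
    total σ Es i                        ∎
    where rest = total σ Rs i
  decreased : totalExcess (E′ ∷ F′ ∷ Rs) < totalExcess Es
  decreased = begin-strict
    excess E′ + (excess F′ + rest)  ≡⟨ +-assoc (excess E′) (excess F′) rest ⟨
    excess E′ + excess F′ + rest    <⟨ +-monoˡ-< rest (excess-decreases p balanced i Ei≰1 Fi≡0) ⟩
    excess E + excess F + rest      ≡⟨ +-assoc (excess E) (excess F) rest ⟩
    excess E + (excess F + rest)    ≡⟨ total-↭ excess Es↭ ⟨
    totalExcess Es                  ∎
    where rest = totalExcess Rs

-- If `E` uses `i` at least twice, the others use `i` less often than their number, so one of them
-- misses `i`; balancing it with `E` lowers the excess.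
improve : ∀ (Es : List (Vec (Fin n) s)) → Few Es → ¬ All Simple Es →
  ∃[ Fs ] (Rearranged Es Fs × totalExcess Fs < totalExcess Es)
improve {s = s} Es few ¬simple with pick (¬All⇒Any¬ Simple? Es ¬simple)
... | E , Rs , ¬simpleE , Es↭ with ¬∀⟶∃¬ _ _ (λ i → mult E i ≤? 1) ¬simpleE
... | i , Ei≰1 with pick (missing Rs fewer)
  where
  open ≤-Reasoning
  fewer : total (replicate s 1) Rs i < length Rs
  fewer = s≤s⁻¹ (begin-strict
    suc (total (replicate s 1) Rs i)       <⟨ +-monoˡ-≤ _ (≰⇒> Ei≰1) ⟩
    mult E i + total (replicate s 1) Rs i  ≡⟨ total-↭ (λ E → mult E i) Es↭ ⟨
    total (replicate s 1) Es i             ≤⟨ few i ⟩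
    length Es                              ≡⟨ ↭-length Es↭ ⟩
    suc (length Rs)                        ∎)
... | F , Qs , Fi≡0 , Rs↭ = rebalance (↭-trans Es↭ (prep E Rs↭)) Ei≰1 Fi≡0

-- De Werra's form of König's edge colouring theorem.
separate : (Es : List (Vec (Fin n) s)) → Few Es → ∃[ Fs ] (Rearranged Es Fs × All Simple Fs)
separate {n} {s} Es = go (suc (totalExcess Es)) Es ≤-refl
  where
  go : ∀ k (Es : List (Vec (Fin n) s)) → totalExcess Es < k → Few Es →
    ∃[ Fs ] (Rearranged Es Fs × All Simple Fs)
  -- `k` strictly bounds the total excess, so zero fuel is impossible.
  go (suc k) Es excess<k few with All.all? Simple? Es
  ... | yes simple = Es , record { length≡ = refl ; total≡ = λ _ _ → refl } , simple
  ... | no ¬simple =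
    let Fs , p  , decreased = improve Es few ¬simple
        Gs , p′ , simple    = go k Fs (<-≤-trans decreased (s≤s⁻¹ excess<k)) (Few-resp p few)
    in Gs , record
      { length≡ = trans (length≡ p′) (length≡ p)
      ; total≡ = λ σ i → trans (total≡ p′ σ i) (total≡ p σ i)
      } , simple

-- From simple placements to matchings

∣++∣ : ∀ {m n} (p : Subset m) (p′ : Subset n) → ∣ p ++ p′ ∣ ≡ ∣ p ∣ + ∣ p′ ∣
∣++∣ []            p′ = refl
∣++∣ (inside  ∷ p) p′ = cong suc (∣++∣ p p′)
∣++∣ (outside ∷ p) p′ = ∣++∣ p p′

⊥++⊥ : ∀ m {n} → ⊥ {m} ++ ⊥ {n} ≡ ⊥
⊥++⊥ zero    = refl
⊥++⊥ (suc m) = cong (outside ∷_) (⊥++⊥ m)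

∣∪∣ : ∀ (p p′ : Subset n) → Empty (p ∩ p′) → ∣ p ∪ p′ ∣ ≡ ∣ p ∣ + ∣ p′ ∣
∣∪∣ []            []             _     = refl
∣∪∣ (inside  ∷ p) (inside  ∷ p′) empty = contradiction (zero , Vec.here) empty
∣∪∣ (inside  ∷ p) (outside ∷ p′) empty = cong suc (∣∪∣ p p′ (drop-∷-Empty empty))
∣∪∣ (outside ∷ p) (inside  ∷ p′) empty = trans (cong suc (∣∪∣ p p′ (drop-∷-Empty empty))) (sym (+-suc ∣ p ∣ ∣ p′ ∣))
∣∪∣ (outside ∷ p) (outside ∷ p′) empty = ∣∪∣ p p′ (drop-∷-Empty empty)

≡⊥⇒Empty : {p : Subset n} → p ≡ ⊥ → Empty p
≡⊥⇒Empty refl (_ , x∈⊥) = ∉⊥ x∈⊥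

∈⋃⁻ : ∀ (M : List (Subset n)) {x} → x ∈ ⋃ M → Any (x ∈_) M
∈⋃⁻ []      x∈⊥ = contradiction x∈⊥ ∉⊥
∈⋃⁻ (p ∷ M) x∈∪ = [ here , there ∘ ∈⋃⁻ M ]′ (x∈p∪q⁻ p (⋃ M) x∈∪)

∩⋃-empty : ∀ {p} (M : List (Subset n)) → All (λ p′ → Empty (p ∩ p′)) M → Empty (p ∩ ⋃ M)
∩⋃-empty {p = p} M disjoint (x , x∈) =
  let x∈p , x∈⋃ = x∈p∩q⁻ p (⋃ M) x∈
  in All¬⇒¬Any (All.map (λ empty x∈p′ → empty (x , x∈p∩q⁺ (x∈p , x∈p′))) disjoint) (∈⋃⁻ M x∈⋃)

∣⋃∣ : ∀ {r} (M : List (Subset n)) → All (λ p → ∣ p ∣ ≡ r) M →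
  AllPairs (λ p p′ → Empty (p ∩ p′)) M → ∣ ⋃ M ∣ ≡ length M * r
∣⋃∣ {n} []  []           []                = ∣⊥∣≡0 n
∣⋃∣ (p ∷ M) (∣p∣≡r ∷ ∣M∣) (pM ∷ disjoint) =
  trans (∣∪∣ p (⋃ M) (∩⋃-empty M pM)) (cong₂ _+_ ∣p∣≡r (∣⋃∣ M ∣M∣ disjoint))

-- An edge equal to one disjoint from it would be empty, against `0 < r`.
disjoint⇒unique : ∀ {r} (M : List (Subset n)) → 0 < r → All (λ p → ∣ p ∣ ≡ r) M →
  AllPairs (λ p p′ → Empty (p ∩ p′)) M → Unique M
disjoint⇒unique []      _   []            []              = []
disjoint⇒unique {n} {r} (p ∷ M) 0<r (∣p∣≡r ∷ ∣M∣) (pM ∷ disjoint) =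
  All.map distinct pM ∷ disjoint⇒unique M 0<r ∣M∣ disjoint
  where
  distinct : ∀ {p′} → Empty (p ∩ p′) → p ≢ p′
  distinct empty refl = contradiction 0<r (≤⇒≯ (≤-reflexive
    (trans (sym ∣p∣≡r) (trans (cong ∣_∣ (Empty-unique (subst Empty (∩-idem p) empty))) (∣⊥∣≡0 n)))))

module _ (n r q : ℕ) {s : ℕ} (σ : Vec ℕ s) where
  private H = σ-hypergraph n r q σ

  matched : ∀ {M} → IsMatching H M → ∣ ⋃ M ∣ ≡ length M * r
  matched {M} matching = ∣⋃∣ M (All.map proj₁ (IsMatching.edges matching)) (IsMatching.disjoint matching)

  matching-bound : ∀ {M} → IsMatching H M → length M * r ≤ n * q
  matching-bound {M} matching = subst (_≤ n * q) (matched matching) (∣p∣≤n (⋃ M))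

  unmatched : ∀ {M k} → IsMatching H M → n * q ≤ length M * r + k → ∣ ∁ (⋃ M) ∣ ≤ k
  unmatched {M} {k} matching few = begin
    ∣ ∁ (⋃ M) ∣               ≡⟨ ∣∁p∣≡n∸∣p∣ (⋃ M) ⟩
    n * q ∸ ∣ ⋃ M ∣           ≡⟨ cong (n * q ∸_) (matched matching) ⟩
    n * q ∸ length M * r      ≤⟨ m≤n+o⇒m∸n≤o (n * q) (length M * r) few ⟩
    k                         ∎
    where open ≤-Reasoning

  perfect : ∀ {M} → IsMatching H M → length M * r ≡ n * q → IsPerfectMatching H M
  perfect {M} matching full =
    matching , λ v → ∈⋃⁻ M (subst (v ∈_) (sym (∣p∣≡n⇒p≡⊤ (trans (matched matching) full))) ∈⊤)

-- Intervals of vertices inside the classes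

tabulate-+ : ∀ {A : Set} m {n} (f : Fin (m + n) → A) →
  tabulate f ≡ tabulate (λ i → f (i ↑ˡ n)) ++ tabulate (λ i → f (m ↑ʳ i))
tabulate-+ zero    f = refl
tabulate-+ (suc m) f = cong (f zero ∷_) (tabulate-+ m (f ∘ suc))

tabulate-const : ∀ {A : Set} n (x : A) → tabulate {n = n} (λ _ → x) ≡ replicate n x
tabulate-const zero    x = refl
tabulate-const (suc n) x = cong (x ∷_) (tabulate-const n x)

module _ (n q : ℕ) where
  quotient-↑ˡ : ∀ j → quotient {suc n} q (j ↑ˡ (n * q)) ≡ zero
  quotient-↑ˡ j rewrite splitAt-↑ˡ q j (n * q) = refl

  quotient-↑ʳ : ∀ v → quotient {suc n} q (q ↑ʳ v) ≡ suc (quotient {n} q v)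
  quotient-↑ʳ v rewrite splitAt-↑ʳ q (n * q) v = refl

  -- The first class is the first block of `q` vertices; with `V-suc` this permits induction on the
  -- number of classes.
  V-zero : V (suc n) q zero ≡ ⊤ {q} ++ ⊥ {n * q}
  V-zero = trans (tabulate-+ q _) (cong₂ _++_
    (trans (tabulate-cong (λ j → cong (λ i → does (i Fin.≟ zero)) (quotient-↑ˡ j))) (tabulate-const q inside))
    (trans (tabulate-cong (λ v → cong (λ i → does (i Fin.≟ zero)) (quotient-↑ʳ v))) (tabulate-const (n * q) outside)))

  V-suc : ∀ i → V (suc n) q (suc i) ≡ ⊥ ++ V n q i
  V-suc i = trans (tabulate-+ q _) (cong₂ _++_
    (trans (tabulate-cong (λ j → cong (λ i′ → does (i′ Fin.≟ suc i)) (quotient-↑ˡ j))) (tabulate-const q outside))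
    (tabulate-cong (λ v → cong (λ i′ → does (i′ Fin.≟ suc i)) (quotient-↑ʳ v))))

interval : ∀ q (start len : ℕ) → Subset q
interval zero    _       _       = []
interval (suc q) (suc o) ℓ       = outside ∷ interval q o ℓ
interval (suc q) zero    (suc ℓ) = inside  ∷ interval q zero ℓ
interval (suc q) zero    zero    = outside ∷ interval q zero zero

∣interval∣ : ∀ q o ℓ → o + ℓ ≤ q → ∣ interval q o ℓ ∣ ≡ ℓ
∣interval∣ zero    zero    zero    _   = refl
∣interval∣ (suc q) (suc o) ℓ       fit = ∣interval∣ q o ℓ (s≤s⁻¹ fit)
∣interval∣ (suc q) zero    (suc ℓ) fit = cong suc (∣interval∣ q zero ℓ (s≤s⁻¹ fit))
∣interval∣ (suc q) zero    zero    _   = ∣interval∣ q zero zero z≤n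

interval-disjoint : ∀ q o ℓ o′ ℓ′ → o + ℓ ≤ o′ → interval q o ℓ ∩ interval q o′ ℓ′ ≡ ⊥
interval-disjoint zero    _       _       _        _        _     = refl
interval-disjoint (suc q) (suc o) ℓ       (suc o′) ℓ′       below = cong (outside ∷_) (interval-disjoint q o ℓ o′ ℓ′ (s≤s⁻¹ below))
interval-disjoint (suc q) zero    (suc ℓ) (suc o′) ℓ′       below = cong (outside ∷_) (interval-disjoint q zero ℓ o′ ℓ′ (s≤s⁻¹ below))
interval-disjoint (suc q) zero    zero    (suc o′) ℓ′       _     = cong (outside ∷_) (interval-disjoint q zero zero o′ ℓ′ z≤n)
interval-disjoint (suc q) zero    zero    zero     (suc ℓ′) _     = cong (outside ∷_) (interval-disjoint q zero zero zero ℓ′ z≤n)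
interval-disjoint (suc q) zero    zero    zero     zero     _     = cong (outside ∷_) (interval-disjoint q zero zero zero zero z≤n)

intervals : ∀ n q → (start len : Fin n → ℕ) → Subset (n * q)
intervals zero    q o ℓ = []
intervals (suc n) q o ℓ = interval q (o zero) (ℓ zero) ++ intervals n q (o ∘ suc) (ℓ ∘ suc)

∣intervals∣ : ∀ n q (o ℓ : Fin n → ℕ) → (∀ i → o i + ℓ i ≤ q) → ∣ intervals n q o ℓ ∣ ≡ sum ℓ
∣intervals∣ zero    q o ℓ fit = refl
∣intervals∣ (suc n) q o ℓ fit = trans (∣++∣ (interval q (o zero) (ℓ zero)) _)
  (cong₂ _+_ (∣interval∣ q (o zero) (ℓ zero) (fit zero)) (∣intervals∣ n q (o ∘ suc) (ℓ ∘ suc) (fit ∘ suc)))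

∣++∩++∣ : ∀ {m n} (p p₁ : Subset m) (p′ p₁′ : Subset n) →
  ∣ (p ++ p′) ∩ (p₁ ++ p₁′) ∣ ≡ ∣ p ∩ p₁ ∣ + ∣ p′ ∩ p₁′ ∣
∣++∩++∣ p p₁ p′ p₁′ = trans (cong ∣_∣ (zipWith-++ _ p p′ p₁ p₁′)) (∣++∣ (p ∩ p₁) (p′ ∩ p₁′))

∣intervals∩V∣ : ∀ n q (o ℓ : Fin n → ℕ) → (∀ i → o i + ℓ i ≤ q) →
  ∀ i → ∣ intervals n q o ℓ ∩ V n q i ∣ ≡ ℓ i
∣intervals∩V∣ (suc n) q o ℓ fit zero = begin
  ∣ (p ++ p′) ∩ V (suc n) q zero ∣  ≡⟨ cong (λ v → ∣ (p ++ p′) ∩ v ∣) (V-zero n q) ⟩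
  ∣ (p ++ p′) ∩ (⊤ {q} ++ ⊥ {n * q}) ∣  ≡⟨ ∣++∩++∣ p ⊤ p′ ⊥ ⟩
  ∣ p ∩ ⊤ ∣ + ∣ p′ ∩ ⊥ ∣            ≡⟨ cong₂ _+_ (cong ∣_∣ (∩-identityʳ p)) (trans (cong ∣_∣ (∩-zeroʳ p′)) (∣⊥∣≡0 (n * q))) ⟩
  ∣ p ∣ + 0                         ≡⟨ +-identityʳ ∣ p ∣ ⟩
  ∣ p ∣                             ≡⟨ ∣interval∣ q (o zero) (ℓ zero) (fit zero) ⟩
  ℓ zero                            ∎
  where
  open ≡-Reasoning
  p  = interval q (o zero) (ℓ zero)
  p′ = intervals n q (o ∘ suc) (ℓ ∘ suc)
∣intervals∩V∣ (suc n) q o ℓ fit (suc i) = begin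
  ∣ (p ++ p′) ∩ V (suc n) q (suc i) ∣  ≡⟨ cong (λ v → ∣ (p ++ p′) ∩ v ∣) (V-suc n q i) ⟩
  ∣ (p ++ p′) ∩ (⊥ ++ V n q i) ∣       ≡⟨ ∣++∩++∣ p ⊥ p′ (V n q i) ⟩
  ∣ p ∩ ⊥ ∣ + ∣ p′ ∩ V n q i ∣         ≡⟨ cong (_+ ∣ p′ ∩ V n q i ∣) (trans (cong ∣_∣ (∩-zeroʳ p)) (∣⊥∣≡0 q)) ⟩
  ∣ p′ ∩ V n q i ∣                     ≡⟨ ∣intervals∩V∣ n q (o ∘ suc) (ℓ ∘ suc) (fit ∘ suc) i ⟩
  ℓ (suc i)                            ∎
  where
  open ≡-Reasoning
  p  = interval q (o zero) (ℓ zero)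
  p′ = intervals n q (o ∘ suc) (ℓ ∘ suc)

intervals-disjoint : ∀ n q (o ℓ o′ ℓ′ : Fin n → ℕ) → (∀ i → o i + ℓ i ≤ o′ i) →
  intervals n q o ℓ ∩ intervals n q o′ ℓ′ ≡ ⊥
intervals-disjoint zero    q o ℓ o′ ℓ′ below = refl
intervals-disjoint (suc n) q o ℓ o′ ℓ′ below = trans
  (zipWith-++ _ (interval q (o zero) (ℓ zero)) _ (interval q (o′ zero) (ℓ′ zero)) _)
  (trans (cong₂ _++_ (interval-disjoint q _ _ _ _ (below zero)) (intervals-disjoint n q _ _ _ _ (below ∘ suc))) (⊥++⊥ q))

-- Realising simple placements by disjoint edges

δ-self : ∀ (e : Fin n) a → δ e e a ≡ a
δ-self e a rewrite dec-true (e Fin.≟ e) refl = refl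

sum-δ : ∀ (e : Fin n) a → sum (λ i → δ e i a) ≡ a
sum-δ {suc n} zero    a = trans (cong (a +_) (sum-replicate-zero n)) (+-identityʳ a)
sum-δ {suc n} (suc e) a = sum-δ e a

sum-load : ∀ (σ : Vec ℕ s) (E : Vec (Fin n) s) → sum (load σ E) ≡ Vec.sum σ
sum-load {n = n} [] [] = sum-replicate-zero n
sum-load (a ∷ σ) (e ∷ E) = trans (∑-distrib-+ (λ i → δ e i a) (load σ E)) (cong₂ _+_ (sum-δ e a) (sum-load σ E))

mult≡0⇒load≡0 : ∀ (σ : Vec ℕ s) (E : Vec (Fin n) s) i → mult E i ≡ 0 → load σ E i ≡ 0
mult≡0⇒load≡0 []      []      i _ = refl
mult≡0⇒load≡0 (a ∷ σ) (e ∷ E) i mult≡0 with e Fin.≟ i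
... | no _ = mult≡0⇒load≡0 σ E i mult≡0

nonzeros : (Fin n → ℕ) → List ℕ
nonzeros f = filter (λ k → ¬? (k ≟ 0)) (List.tabulate f)

nonzeros-0 : ∀ n → nonzeros {n} (λ _ → 0) ≡ []
nonzeros-0 zero    = refl
nonzeros-0 (suc n) = nonzeros-0 n

-- As class `e` was empty, the new part forms an entry of its own instead of enlarging another.
nonzeros-δ : ∀ (f : Fin n → ℕ) e {a} → 0 < a → f e ≡ 0 → nonzeros (λ i → δ e i a + f i) ↭ a ∷ nonzeros f
nonzeros-δ f zero {suc a} _ fe≡0 rewrite fe≡0 | +-identityʳ a = ↭-refl
nonzeros-δ f (suc e) 0<a fe≡0 with f zero
... | zero  = nonzeros-δ (f ∘ suc) e 0<a fe≡0
... | suc k = ↭-trans (prep (suc k) (nonzeros-δ (f ∘ suc) e 0<a fe≡0)) (swap (suc k) _ ↭-refl)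

-- By simplicity each part enters a class that the remaining parts do not use.
nonzeros-load : ∀ {σ : Vec ℕ s} → VecAll.All (0 <_) σ → ∀ (E : Vec (Fin n) s) → Simple E → nonzeros (load σ E) ↭ toList σ
nonzeros-load {n = n} [] [] _ = ↭-reflexive (nonzeros-0 n)
nonzeros-load {σ = a ∷ σ} (0<a ∷ 0<σ) (e ∷ E) simple = ↭-trans
  (nonzeros-δ (load σ E) e 0<a (mult≡0⇒load≡0 σ E e (n≤0⇒n≡0 (s≤s⁻¹ (subst (λ x → x + mult E e ≤ 1) (δ-self e 1) (simple e))))))
  (prep a (nonzeros-load 0<σ E (λ i → ≤-trans (m≤n+m _ (δ e i 1)) (simple i))))

module _ {n q r s : ℕ} {σ : Vec ℕ s} (partition : IsPartitionOf r σ) (0<r : 0 < r) where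
  private H = σ-hypergraph n r q σ

  -- `o i` counts the vertices of class `i` already used; every edge takes the next free interval in
  -- each class.
  realise : (Fin n → ℕ) → List (Vec (Fin n) s) → List (Subset (n * q))
  realise o []       = []
  realise o (E ∷ Es) = intervals n q o (load σ E) ∷ realise (λ i → o i + load σ E i) Es

  realise-length : ∀ o Es → length (realise o Es) ≡ length Es
  realise-length o []       = refl
  realise-length o (E ∷ Es) = cong suc (realise-length _ Es)

  intervals-edge : ∀ o E → Simple E → (∀ i → o i + load σ E i ≤ q) → Edge H (intervals n q o (load σ E))
  intervals-edge o E simple fit =
    trans (∣intervals∣ n q o (load σ E) fit) (trans (sum-load σ E) (proj₂ partition)) ,
    subst (_↭ toList σ) (cong (filter (λ k → ¬? (k ≟ 0))) (sym tabulated)) (nonzeros-load (proj₁ partition) E simple)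
    where
    K = intervals n q o (load σ E)
    tabulated : List.map (λ i → ∣ K ∩ V n q i ∣) (List.allFin n) ≡ List.tabulate (load σ E)
    tabulated = trans (map-tabulate (λ i → i) _) (List-tabulate-cong (∣intervals∩V∣ n q o (load σ E) fit))

  realise-edges : ∀ o Es → All Simple Es → (∀ i → o i + total σ Es i ≤ q) → All (Edge H) (realise o Es)
  realise-edges o []       _                   _   = []
  realise-edges o (E ∷ Es) (simple ∷ simples) fit =
    intervals-edge o E simple (λ i → ≤-trans (+-monoʳ-≤ (o i) (m≤m+n (load σ E i) (total σ Es i))) (fit i)) ∷
    realise-edges _ Es simples (λ i → subst (_≤ q) (sym (+-assoc (o i) (load σ E i) (total σ Es i))) (fit i))

  realise-above : ∀ o ℓ o′ Es → (∀ i → o i + ℓ i ≤ o′ i) → All (λ K → Empty (intervals n q o ℓ ∩ K)) (realise o′ Es)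
  realise-above o ℓ o′ []       _     = []
  realise-above o ℓ o′ (E ∷ Es) below =
    ≡⊥⇒Empty (intervals-disjoint n q o ℓ o′ (load σ E) below) ∷
    realise-above o ℓ _ Es (λ i → ≤-trans (below i) (m≤m+n (o′ i) (load σ E i)))

  realise-disjoint : ∀ o Es → AllPairs (λ e f → Empty (e ∩ f)) (realise o Es)
  realise-disjoint o []       = []
  realise-disjoint o (E ∷ Es) = realise-above o (load σ E) _ Es (λ _ → ≤-refl) ∷ realise-disjoint _ Es

  realise-matching : ∀ Es → All Simple Es → (∀ i → total σ Es i ≤ q) → IsMatching H (realise (λ _ → 0) Es)
  realise-matching Es simple fit = record
    { edges    = edges
    ; distinct = disjoint⇒unique _ 0<r (All.map proj₁ edges) (realise-disjoint _ Es)
    ; disjoint = realise-disjoint _ Es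
    }
    where edges = realise-edges (λ _ → 0) Es simple fit

-- Splitting c as a X + b Y

∣∧<⇒≡0 : ∀ {m n} → m ∣ n → n < m → n ≡ 0
∣∧<⇒≡0 {n = zero}  _   _   = refl
∣∧<⇒≡0 {n = suc _} m∣n n<m = contradiction n<m (≤⇒≯ (∣⇒≤ m∣n))

unitModulo : ∀ a r → .{{NonZero r}} → Coprime a r → ∃[ d ] ∃[ u ] ∃[ v ] d * a + u * r ≡ 1 + v * r
unitModulo a (suc r) coprime with coprime-Bézout coprime
... | Bézout.+- x y eq = x , 0 , y , trans (+-identityʳ (x * a)) (sym eq)
-- Here x a ≡ -1 modulo `suc r`, and r ≡ -1, so `r * x` is an inverse of `a`.
... | Bézout.-+ x y eq = r * x , 1 , r * y , (begin-equality
  r * x * a + 1 * suc r  ≡⟨ expand r x a ⟩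
  1 + r * (1 + x * a)    ≡⟨ cong (λ z → 1 + r * z) eq ⟩
  1 + r * (y * suc r)    ≡⟨ cong suc (*-assoc r y (suc r)) ⟨
  1 + r * y * suc r      ∎)
  where
  open ≤-Reasoning
  expand : ∀ r x a → r * x * a + 1 * suc r ≡ 1 + r * (1 + x * a)
  expand = solve-∀

-- Scale the inverse of `a` by `c` and reduce it modulo `r`. Multiples of `r` on both sides express
-- the congruence within the naturals.
residueModulo : ∀ a r → .{{_ : NonZero r}} → Coprime a r → ∀ c →
  ∃[ d ] (d < r × ∃[ u ] ∃[ v ] d * a + u * r ≡ c + v * r)
residueModulo a r coprime c with unitModulo a r coprime
... | d₁ , u , v , eq = d % r , m%n<n d r , (d / r) * a + c * u , c * v , (begin-equality
  d % r * a + (d / r * a + c * u) * r    ≡⟨ regroup (d % r) (d / r) a c u r ⟩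
  (d % r + d / r * r) * a + c * u * r    ≡⟨ cong (λ z → z * a + c * u * r) (m≡m%n+[m/n]*n d r) ⟨
  d * a + c * u * r                      ≡⟨ factor c d₁ a u r ⟩
  c * (d₁ * a + u * r)                   ≡⟨ cong (c *_) eq ⟩
  c * (1 + v * r)                        ≡⟨ expand c v r ⟩
  c + c * v * r                          ∎)
  where
  open ≤-Reasoning
  d = c * d₁
  regroup : ∀ e f a c u r → e * a + (f * a + c * u) * r ≡ (e + f * r) * a + c * u * r
  regroup = solve-∀
  factor : ∀ c d a u r → c * d * a + c * u * r ≡ c * (d * a + u * r)
  factor = solve-∀
  expand : ∀ c v r → c * (1 + v * r) ≡ c + c * v * r
  expand = solve-∀

-- For positive `a` the sides differ by exactly one, which is where Sylvester's bound comes from.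
[a∸1][r∸1]+r>[r∸1]a : ∀ a r → .{{NonZero r}} → (r ∸ 1) * a < (a ∸ 1) * (r ∸ 1) + r
[a∸1][r∸1]+r>[r∸1]a zero    (suc r) rewrite *-zeroʳ r = s≤s z≤n
[a∸1][r∸1]+r>[r∸1]a (suc a) (suc r) = ≤-reflexive (identity a r)
  where
  identity : ∀ a r → suc (r * suc a) ≡ a * r + suc r
  identity = solve-∀

-- Sylvester's bound for the Frobenius problem, with a normalised coefficient.
sylvester : ∀ a r → .{{_ : NonZero r}} → Coprime a r → ∀ {c} → (a ∸ 1) * (r ∸ 1) ≤ c →
  ∃[ d ] (d < r × ∃[ y ] c ≡ d * a + y * r)
sylvester a r coprime {c} large with residueModulo a r coprime c
... | d , d<r , u , v , eq with ≤-total (d * a) c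
... | inj₁ da≤c with m≤n⇒∃[o]m+o≡n da≤c
...   | t , refl = d , d<r , quotientOf (∣m+n∣m⇒∣n r∣vr+t (n∣m*n v))
  where
  r∣vr+t : r ∣ v * r + t
  r∣vr+t = divides u (trans (+-comm (v * r) t) (sym (+-cancelˡ-≡ (d * a) _ _ (trans eq (+-assoc (d * a) t (v * r))))))
  quotientOf : r ∣ t → ∃[ y ] d * a + t ≡ d * a + y * r
  quotientOf (divides y t≡yr) = y , cong (d * a +_) t≡yr
sylvester a r coprime {c} large | d , d<r , u , v , eq | inj₂ c≤da with m≤n⇒∃[o]m+o≡n c≤da
... | zero  , c+0≡da = d , d<r , 0 , trans (sym (+-identityʳ c)) (trans c+0≡da (sym (+-identityʳ (d * a))))
-- `d * a` would exceed `c` by a positive multiple of `r`, hence by at least `r`, although d ≤ r -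
-- 1.
... | suc t , c+t≡da = contradiction ([a∸1][r∸1]+r>[r∸1]a a r) (≤⇒≯ (begin
  (a ∸ 1) * (r ∸ 1) + r  ≤⟨ +-mono-≤ large (∣⇒≤ r∣t) ⟩
  c + suc t              ≡⟨ c+t≡da ⟩
  d * a                  ≤⟨ *-monoˡ-≤ a (pred-mono-≤ d<r) ⟩
  (r ∸ 1) * a            ∎))
  where
  open ≤-Reasoning
  ur+t≡vr : u * r + suc t ≡ v * r
  ur+t≡vr = +-cancelˡ-≡ c _ _ (begin-equality
    c + (u * r + suc t)  ≡⟨ cong (c +_) (+-comm (u * r) (suc t)) ⟩
    c + (suc t + u * r)  ≡⟨ +-assoc c (suc t) (u * r) ⟨
    c + suc t + u * r    ≡⟨ cong (_+ u * r) c+t≡da ⟩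
    d * a + u * r        ≡⟨ eq ⟩
    c + v * r            ∎)
  r∣t : r ∣ suc t
  r∣t = ∣m+n∣m⇒∣n (divides v ur+t≡vr) (n∣m*n u)

-- Splitting all class loads with equal sums

module _ (a b : ℕ) .{{_ : NonZero (a + b)}} (coprime : Coprime a (a + b)) where
  private r = a + b

  -- The bound with `a` yields the solution with X - Y = d, the one with `b` keeps the solution with
  -- X - Y = d - r nonnegative.
  Large : ℕ → Set
  Large c = (a ∸ 1) * (r ∸ 1) ≤ c × (b ∸ 1) * (r ∸ 1) ≤ c

  -- c = X a + Y b has solutions with X - Y in {d , d - r} for a single d in [0 , r);
  -- whichever of the two keeps the running balance in [0 , r) is taken.
  balancedSplit : ∀ {c D} → Large c → D < r →
    ∃[ X ] ∃[ Y ] ∃[ D′ ] (D′ < r × a * X + b * Y ≡ c × X + D ≡ Y + D′)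
  balancedSplit {c} {D} (largeA , largeB) D<r with sylvester a r coprime largeA
  ... | d , d<r , y , refl with d + D <? r
  ... | yes d+D<r = y + d , y , d + D , d+D<r , identity a b y d , +-assoc y d D
    where
    identity : ∀ a b y d → a * (y + d) + b * y ≡ d * a + y * (a + b)
    identity = solve-∀
  ... | no d+D≮r with b ≤? y + d
  -- Trading `b` from X for `a` in Y keeps the weight and lowers X - Y by `r`.
  ...   | yes b≤y+d = y + d ∸ b , y + a , d + D ∸ r , D′<r , weight≡ , balance≡
    where
    open ≤-Reasoning
    r≤d+D = ≮⇒≥ d+D≮r
    D′<r : d + D ∸ r < r
    D′<r = +-cancelʳ-< r _ _ (begin-strict
      d + D ∸ r + r  ≡⟨ m∸n+n≡m r≤d+D ⟩
      d + D          <⟨ +-mono-< d<r D<r ⟩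
      r + r          ∎)
    x = y + d ∸ b
    expand : ∀ a b x y → a * x + b * (y + a) ≡ a * (x + b) + b * y
    expand = solve-∀
    collect : ∀ a b y d → a * (y + d) + b * y ≡ d * a + y * (a + b)
    collect = solve-∀
    weight≡ : a * x + b * (y + a) ≡ d * a + y * r
    weight≡ = begin-equality
      a * x + b * (y + a)    ≡⟨ expand a b x y ⟩
      a * (x + b) + b * y    ≡⟨ cong (λ z → a * z + b * y) (m∸n+n≡m b≤y+d) ⟩
      a * (y + d) + b * y    ≡⟨ collect a b y d ⟩
      d * a + y * r          ∎
    shuffle : ∀ x D b → x + D + b ≡ x + b + D
    shuffle = solve-∀
    shuffle′ : ∀ y a b z → y + (z + (a + b)) ≡ y + a + z + b
    shuffle′ = solve-∀
    balance≡ : x + D ≡ y + a + (d + D ∸ r)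
    balance≡ = +-cancelʳ-≡ b _ _ (begin-equality
      x + D + b                  ≡⟨ shuffle x D b ⟩
      x + b + D                  ≡⟨ cong (_+ D) (m∸n+n≡m b≤y+d) ⟩
      y + d + D                  ≡⟨ +-assoc y d D ⟩
      y + (d + D)                ≡⟨ cong (y +_) (m∸n+n≡m r≤d+D) ⟨
      y + (d + D ∸ r + r)        ≡⟨ shuffle′ y a b (d + D ∸ r) ⟩
      y + a + (d + D ∸ r) + b    ∎)
  -- Now y + d + 1 ≤ b, so c + r + d b = (y + d + 1) r ≤ b r. As d > 0, this contradicts the bound
  -- with `b`.
  ...   | no b≰y+d = contradiction ([a∸1][r∸1]+r>[r∸1]a b r) (≤⇒≯ (+-cancelʳ-≤ b _ _ (begin
    (b ∸ 1) * (r ∸ 1) + r + b        ≤⟨ +-monoˡ-≤ b (+-monoˡ-≤ r largeB) ⟩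
    d * a + y * r + r + b            ≤⟨ +-monoʳ-≤ (d * a + y * r + r) (m≤n*m b d {{>-nonZero d>0}}) ⟩
    d * a + y * r + r + d * b        ≡⟨ collect a b d y ⟩
    suc (y + d) * r                  ≤⟨ *-monoˡ-≤ r (≰⇒> b≰y+d) ⟩
    b * r                            ≡⟨ *-comm b r ⟩
    r * b                            ≡⟨ cong (_* b) (m∸n+n≡m (>-nonZero⁻¹ r)) ⟨
    (r ∸ 1 + 1) * b                  ≡⟨ split (r ∸ 1) b ⟩
    (r ∸ 1) * b + b                  ∎)))
    where
    open ≤-Reasoning
    d>0 : 0 < d
    d>0 = n≢0⇒n>0 λ d≡0 → d+D≮r (subst (λ d → d + D < r) (sym d≡0) D<r)
    collect : ∀ a b d y → d * a + y * (a + b) + (a + b) + d * b ≡ suc (y + d) * (a + b)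
    collect = solve-∀
    split : ∀ t b → (t + 1) * b ≡ t * b + b
    split = solve-∀

  balancedSplits : ∀ (c : Fin n → ℕ) {D} → (∀ i → Large (c i)) → D < r →
    ∃[ X ] ∃[ Y ] ∃[ D′ ] (D′ < r × (∀ i → a * X i + b * Y i ≡ c i) × sum X + D ≡ sum Y + D′)
  balancedSplits {zero}  c {D} large D<r = (λ ()) , (λ ()) , D , D<r , (λ ()) , refl
  balancedSplits {suc n} c {D} large D<r
    with balancedSplit (large zero) D<r
  ... | x , y , D₁ , D₁<r , weight≡ , balance≡
    with balancedSplits (c ∘ suc) (large ∘ suc) D₁<r
  ... | X , Y , D₂ , D₂<r , weights , balances =
    (λ { zero → x ; (suc i) → X i }) , (λ { zero → y ; (suc i) → Y i }) , D₂ , D₂<r ,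
    (λ { zero → weight≡ ; (suc i) → weights i }) , (begin-equality
      x + sum X + D     ≡⟨ shuffle x (sum X) D ⟩
      sum X + (x + D)   ≡⟨ cong (sum X +_) balance≡ ⟩
      sum X + (y + D₁)  ≡⟨ shuffle′ (sum X) y D₁ ⟩
      y + (sum X + D₁)  ≡⟨ cong (y +_) balances ⟩
      y + (sum Y + D₂)  ≡⟨ +-assoc y (sum Y) D₂ ⟨
      y + sum Y + D₂    ∎)
    where
    open ≤-Reasoning
    shuffle : ∀ x X D → x + X + D ≡ X + (x + D)
    shuffle = solve-∀
    shuffle′ : ∀ X y D → X + (y + D) ≡ y + (X + D)
    shuffle′ = solve-∀

  sum-weights : ∀ (X Y : Fin n → ℕ) → sum (λ i → a * X i + b * Y i) ≡ a * sum X + b * sum Y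
  sum-weights {zero}  X Y = sym (cong₂ _+_ (*-zeroʳ a) (*-zeroʳ b))
  sum-weights {suc n} X Y = trans (cong (a * X zero + b * Y zero +_) (sum-weights (X ∘ suc) (Y ∘ suc)))
    (shuffle a b (X zero) (Y zero) (sum (X ∘ suc)) (sum (Y ∘ suc)))
    where
    shuffle : ∀ a b x y X Y → a * x + b * y + (a * X + b * Y) ≡ a * (x + X) + b * (y + Y)
    shuffle = solve-∀

  -- Starting from balance 0, the final balance `D` satisfies r ΣY + a D = r m. So `r` divides `D`
  -- by coprimality, and `D < r` forces `D` to be 0.
  equalSplits : ∀ (c : Fin n → ℕ) {m} → (∀ i → Large (c i)) → sum c ≡ r * m →
    ∃[ X ] ∃[ Y ] ((∀ i → a * X i + b * Y i ≡ c i) × sum X ≡ m × sum Y ≡ m)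
  equalSplits c {m} large sum-c with balancedSplits c {0} large (>-nonZero⁻¹ r)
  ... | X , Y , D , D<r , weights , balance≡ =
    X , Y , weights , trans sumX≡sumY sumY≡m , sumY≡m
    where
    open ≤-Reasoning
    expand : ∀ a b y D → a * (y + D) + b * y ≡ (a + b) * y + a * D
    expand = solve-∀
    rY+aD≡rm : r * sum Y + a * D ≡ r * m
    rY+aD≡rm = begin-equality
      r * sum Y + a * D                ≡⟨ expand a b (sum Y) D ⟨
      a * (sum Y + D) + b * sum Y      ≡⟨ cong (λ z → a * z + b * sum Y) (trans (sym (+-identityʳ (sum X))) balance≡) ⟨
      a * sum X + b * sum Y            ≡⟨ sum-weights X Y ⟨
      sum (λ i → a * X i + b * Y i)    ≡⟨ sum-cong-≗ weights ⟩
      sum c                            ≡⟨ sum-c ⟩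
      r * m                            ∎
    r∣D : r ∣ D
    r∣D = coprime-divisor (Coprimality.sym coprime)
      (∣m+n∣m⇒∣n (subst (r ∣_) (sym rY+aD≡rm) (m∣m*n m)) (m∣m*n (sum Y)))
    D≡0 : D ≡ 0
    D≡0 = ∣∧<⇒≡0 r∣D D<r
    sumX≡sumY : sum X ≡ sum Y
    sumX≡sumY = begin-equality
      sum X      ≡⟨ +-identityʳ (sum X) ⟨
      sum X + 0  ≡⟨ balance≡ ⟩
      sum Y + D  ≡⟨ cong (sum Y +_) D≡0 ⟩
      sum Y + 0  ≡⟨ +-identityʳ (sum Y) ⟩
      sum Y      ∎
    sumY≡m : sum Y ≡ m
    sumY≡m = *-cancelˡ-≡ (sum Y) m r (begin-equality
      r * sum Y            ≡⟨ +-identityʳ (r * sum Y) ⟨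
      r * sum Y + 0        ≡⟨ cong (r * sum Y +_) (trans (cong (a *_) D≡0) (*-zeroʳ a)) ⟨
      r * sum Y + a * D    ≡⟨ rY+aD≡rm ⟩
      r * m                ∎)

-- Assembling the matchings

word : (Fin n → ℕ) → List (Fin n)
word {zero}  X = []
word {suc n} X = List.replicate (X zero) zero List.++ map suc (word (X ∘ suc))

length-word : ∀ (X : Fin n → ℕ) → length (word X) ≡ sum X
length-word {zero}  X = refl
length-word {suc n} X = trans (length-++ (List.replicate (X zero) zero))
  (cong₂ _+_ (length-replicate (X zero)) (trans (length-map suc (word (X ∘ suc))) (length-word (X ∘ suc))))

weight : ℕ → List (Fin n) → Fin n → ℕ
weight a es i = listSum (map (λ e → δ e i a) es)

weight-++ : ∀ a (es fs : List (Fin n)) i → weight a (es List.++ fs) i ≡ weight a es i + weight a fs i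
weight-++ a es fs i = trans (cong listSum (map-++ _ es fs)) (sum-++ (map (λ e → δ e i a) es) _)

weight-word : ∀ a (X : Fin n → ℕ) i → weight a (word X) i ≡ a * X i
weight-word {suc n} a X zero = trans (weight-++ a (List.replicate (X zero) zero) _ zero)
  (trans (cong₂ _+_ (zeros (X zero)) (sucs (word (X ∘ suc)))) (+-identityʳ (a * X zero)))
  where
  zeros : ∀ k → weight a (List.replicate k zero) (zero {n}) ≡ a * k
  zeros zero    = sym (*-zeroʳ a)
  zeros (suc k) = trans (cong (a +_) (zeros k)) (sym (*-suc a k))
  sucs : ∀ (es : List (Fin n)) → weight a (map suc es) zero ≡ 0
  sucs []       = refl
  sucs (e ∷ es) = sucs es
weight-word {suc n} a X (suc i) = trans (weight-++ a (List.replicate (X zero) zero) _ (suc i))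
  (cong₂ _+_ (zeros (X zero)) (trans (sucs (word (X ∘ suc))) (weight-word a (X ∘ suc) i)))
  where
  zeros : ∀ k → weight a (List.replicate k zero) (suc i) ≡ 0
  zeros zero    = refl
  zeros (suc k) = zeros k
  sucs : ∀ (es : List (Fin n)) → weight a (map suc es) (suc i) ≡ weight a es i
  sucs []       = refl
  sucs (e ∷ es) = cong (δ e i a +_) (sucs es)

sumOver-∁ : ∀ (A : Subset s) σ → sumOver A σ + sumOver (∁ A) σ ≡ Vec.sum σ
sumOver-∁ []            []      = refl
sumOver-∁ (inside  ∷ A) (a ∷ σ) = trans (+-assoc a (sumOver A σ) _) (cong (a +_) (sumOver-∁ A σ))
sumOver-∁ (outside ∷ A) (a ∷ σ) = trans (shuffle (sumOver A σ) a _) (cong (a +_) (sumOver-∁ A σ))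
  where
  shuffle : ∀ x a y → x + (a + y) ≡ a + (x + y)
  shuffle = solve-∀

-- Bounds how often a class is used by its load.
sumOver-ones : ∀ (A : Subset s) {σ} → VecAll.All (0 <_) σ → sumOver A (replicate s 1) ≤ sumOver A σ
sumOver-ones []            []          = z≤n
sumOver-ones (inside  ∷ A) (0<a ∷ 0<σ) = +-mono-≤ 0<a (sumOver-ones A 0<σ)
sumOver-ones (outside ∷ A) (0<a ∷ 0<σ) = sumOver-ones A 0<σ

sum-ones : ∀ s → Vec.sum (replicate s 1) ≡ s
sum-ones zero    = refl
sum-ones (suc s) = cong suc (sum-ones s)

complement-unique : ∀ (A B : Subset s) → Empty (A ∩ B) → A ∪ B ≡ ⊤ → B ≡ ∁ A
complement-unique []            []            _     _    = refl
complement-unique (inside  ∷ A) (inside  ∷ B) empty _    = contradiction (zero , Vec.here) empty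
complement-unique (inside  ∷ A) (outside ∷ B) empty full = cong (outside ∷_) (complement-unique A B (drop-∷-Empty empty) (∷-injectiveʳ full))
complement-unique (outside ∷ A) (inside  ∷ B) empty full = cong (inside ∷_) (complement-unique A B (drop-∷-Empty empty) (∷-injectiveʳ full))
complement-unique (outside ∷ A) (outside ∷ B) _     full with ∷-injectiveˡ full
... | ()

δ-+ : ∀ (e i : Fin n) a b → δ e i (a + b) ≡ δ e i a + δ e i b
δ-+ e i a b with e Fin.≟ i
... | yes _ = refl
... | no  _ = refl

-- The degenerate edges to start from: their loads depend on `σ` only through the sums over `A` and
-- `∁ A`.
lump : Subset s → Fin n → Fin n → Vec (Fin n) s
lump A u v = Vec.map (λ j∈A → if j∈A then u else v) A

load-lump : ∀ (A : Subset s) (u v : Fin n) σ i →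
  load σ (lump A u v) i ≡ δ u i (sumOver A σ) + δ v i (sumOver (∁ A) σ)
load-lump [] u v [] i = sym (cong₂ _+_ (δ-0 u) (δ-0 v))
  where
  δ-0 : ∀ e → δ e i 0 ≡ 0
  δ-0 e with e Fin.≟ i
  ... | yes _ = refl
  ... | no  _ = refl
load-lump (inside ∷ A) u v (a ∷ σ) i = trans (cong (δ u i a +_) (load-lump A u v σ i))
  (trans (sym (+-assoc (δ u i a) _ _)) (cong (_+ δ v i (sumOver (∁ A) σ)) (sym (δ-+ u i a (sumOver A σ)))))
load-lump (outside ∷ A) u v (a ∷ σ) i = trans (cong (δ v i a +_) (load-lump A u v σ i))
  (trans (shuffle (δ v i a) (δ u i (sumOver A σ)) _) (cong (δ u i (sumOver A σ) +_) (sym (δ-+ v i a (sumOver (∁ A) σ)))))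
  where
  shuffle : ∀ x y z → x + (y + z) ≡ y + (x + z)
  shuffle = solve-∀

total-lumps : ∀ (A : Subset s) (us vs : List (Fin n)) → length us ≡ length vs → ∀ σ i →
  total σ (zipWith (lump A) us vs) i ≡ weight (sumOver A σ) us i + weight (sumOver (∁ A) σ) vs i
total-lumps A []       []       _  σ i = refl
total-lumps A (u ∷ us) (v ∷ vs) eq σ i = trans
  (cong₂ _+_ (load-lump A u v σ i) (total-lumps A us vs (suc-injective eq) σ i))
  (interchange (δ u i (sumOver A σ)) (δ v i (sumOver (∁ A) σ)) _ _)
  where
  interchange : ∀ x y z t → (x + y) + (z + t) ≡ (x + z) + (y + t)
  interchange = solve-∀

HasMatching : Hypergraph → ℕ → Set
HasMatching H k = ∃[ M ] (IsMatching H M × length M ≡ k)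

-- The first inequality is `Few` for the lumped edges, the second keeps them within the classes;
-- `separate` preserves both totals.
matching-from-splits : ∀ {n r q s m} {σ : Vec ℕ s} → IsPartitionOf r σ → 0 < r → ∀ A (X Y : Fin n → ℕ) →
  sum X ≡ m → sum Y ≡ m →
  (∀ i → sumOver A (replicate s 1) * X i + sumOver (∁ A) (replicate s 1) * Y i ≤ m) →
  (∀ i → sumOver A σ * X i + sumOver (∁ A) σ * Y i ≤ q) →
  HasMatching (σ-hypergraph n r q σ) m
matching-from-splits {n} {r} {q} {s} {m} {σ} partition 0<r A X Y sumX sumY few fit =
  let Fs , p , simple = separate Es (λ i → subst₂ _≤_ (sym (totals (replicate s 1) i)) (sym length-Es) (few i))
  in realise partition 0<r (λ _ → 0) Fs ,
     realise-matching partition 0<r Fs simple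
       (λ i → subst (_≤ q) (sym (trans (Rearranged.total≡ p σ i) (totals σ i))) (fit i)) ,
     trans (realise-length partition 0<r _ Fs) (trans (Rearranged.length≡ p) length-Es)
  where
  -- Any pairing of the two words would do, since only totals matter.
  Es = zipWith (lump A) (word X) (word Y)
  lengthX : length (word X) ≡ m
  lengthX = trans (length-word X) sumX
  lengthY : length (word Y) ≡ m
  lengthY = trans (length-word Y) sumY
  length-Es : length Es ≡ m
  length-Es = trans (length-zipWith (lump A) (word X) (word Y)) (trans (cong₂ _⊓_ lengthX lengthY) (⊓-idem m))
  totals : ∀ τ i → total τ Es i ≡ sumOver A τ * X i + sumOver (∁ A) τ * Y i
  totals τ i = trans (total-lumps A (word X) (word Y) (trans lengthX (sym lengthY)) τ i)
    (cong₂ _+_ (weight-word (sumOver A τ) X i) (weight-word (sumOver (∁ A) τ) Y i))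

-- Existence of the matching number by exhaustive search

infix 4 _↭?_

_↭?_ : ∀ (xs ys : List ℕ) → Dec (xs ↭ ys)
[]       ↭? []       = yes ↭-refl
[]       ↭? (y ∷ ys) = no (¬x∷xs↭[] ∘ ↭-sym)
(x ∷ xs) ↭? ys with any? (x ≟_) ys
... | no  x∉ys = no λ xxs↭ys → x∉ys (∈-resp-↭ xxs↭ys (here refl))
... | yes x∈ys with pick x∈ys
...   | .x , zs , refl , ys↭xzs = map′
  (λ xs↭zs → ↭-trans (prep x xs↭zs) (↭-sym ys↭xzs))
  (λ xxs↭ys → drop-∷ (↭-trans xxs↭ys ys↭xzs))
  (xs ↭? zs)

anyOfLength? : ∀ {A : Set} → (∀ {P : A → Set} → Decidable P → Dec (∃[ x ] P x)) →
  ∀ k {P : List A → Set} → Decidable P → Dec (∃[ xs ] (P xs × length xs ≡ k))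
anyOfLength? any zero    P? = map′ (λ p → [] , p , refl) (λ { ([] , p , refl) → p }) (P? [])
anyOfLength? any (suc k) P? = map′
  (λ { (x , xs , p , eq) → x ∷ xs , p , cong suc eq })
  (λ { (x ∷ xs , p , eq) → x , xs , p , suc-injective eq })
  (any (λ x → anyOfLength? any k (λ xs → P? (x ∷ xs))))

greatest : ∀ {P : ℕ → Set} → Decidable P → P 0 → ∀ N → (∀ k → P k → k ≤ N) →
  ∃[ m ] (P m × (∀ k → P k → k ≤ m))
greatest P? p₀ zero    bound = 0 , p₀ , bound
greatest P? p₀ (suc N) bound with P? (suc N)
... | yes p = suc N , p , bound
... | no ¬p = greatest P? p₀ N λ k pk → s≤s⁻¹ (≤∧≢⇒< (bound k pk) λ { refl → ¬p pk })

isMatching? : ∀ H → Decidable (Edge H) → Decidable (IsMatching H)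
isMatching? H edge? M = map′
  (λ { (e , u , d) → record { edges = e ; distinct = u ; disjoint = d } })
  (λ m → IsMatching.edges m , IsMatching.distinct m , IsMatching.disjoint m)
  (All.all? edge? M ×-dec allPairs? (λ e f → ¬? (≡-dec Bool._≟_ e f)) M
    ×-dec allPairs? (λ e f → ¬? (nonempty? (e ∩ f))) M)

-- Having a matching of a given size is decidable, and sizes are at most `n * q` because edges are
-- nonempty.
matchingNumber : ∀ n r q {s} (σ : Vec ℕ s) → 0 < r → ∃[ ν ] IsMatchingNumber (σ-hypergraph n r q σ) ν
matchingNumber n r q σ 0<r =
  let ν , attained , maximal = greatest (λ k → anyOfLength? anySubset? k (isMatching? H edge?))
        ([] , record { edges = [] ; distinct = [] ; disjoint = [] } , refl) (n * q) bound
  in ν , attained , λ M matching → maximal (length M) (M , matching , refl)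
  where
  H = σ-hypergraph n r q σ
  edge? : Decidable (Edge H)
  edge? K = (∣ K ∣ ≟ r) ×-dec (_ ↭? toList σ)
  bound : ∀ k → HasMatching H k → k ≤ n * q
  bound _ (M , matching , refl) = ≤-trans (m≤m*n (length M) r {{>-nonZero 0<r}}) (matching-bound n r q σ matching)

-- The three cases of the theorem

sum-const : ∀ n k → sum {n} (λ _ → k) ≡ n * k
sum-const zero    k = refl
sum-const (suc n) k = cong (k +_) (sum-const n k)

m≤m² : ∀ m → m ≤ m ^ 2
m≤m² zero    = z≤n
m≤m² (suc m) = m≤m*n (suc m) (suc m * 1)

module _ (n q s : ℕ) (σ : Vec ℕ s) (A : Subset s) where
  private
    a = sumOver A σ
    b = sumOver (∁ A) σ
    r = a + b
    L = a * b
    H = σ-hypergraph n r q σ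

  module _ (partition : IsPartitionOf r σ) (coprimeA : Coprime a r) (coprimeB : Coprime b r) where

    -- Zero is coprime to `r` only if r = 1. Then all bounds with the factor `r ∸ 1` vanish;
    -- otherwise `L` is at least `a` and `b`.
    trivial⊎positive : r ≡ 1 ⊎ (0 < a × 0 < b)
    trivial⊎positive with a ≟ 0 | b ≟ 0
    ... | yes a≡0 | _       = inj₁ (0-coprimeTo-m⇒m≡1 (subst (λ x → Coprime x r) a≡0 coprimeA))
    ... | no  _   | yes b≡0 = inj₁ (0-coprimeTo-m⇒m≡1 (subst (λ x → Coprime x r) b≡0 coprimeB))
    ... | no  a≢0 | no b≢0  = inj₂ (n≢0⇒n>0 a≢0 , n≢0⇒n>0 b≢0)

    0<r : 0 < r
    0<r = [ (λ r≡1 → ≤-reflexive (sym r≡1)) , (λ (0<a , _) → ≤-trans 0<a (m≤m+n a b)) ]′ trivial⊎positive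

    instance
      r≢0 : NonZero r
      r≢0 = >-nonZero 0<r

    large : ∀ {c} → (L ∸ 1) * (r ∸ 1) ≤ c → Large a b coprimeA c
    large {c} bound with trivial⊎positive
    ... | inj₁ r≡1 = trivially a , trivially b
      where
      trivially : ∀ x → (x ∸ 1) * (r ∸ 1) ≤ c
      trivially x = ≤-trans (≤-reflexive (trans (cong (λ r → (x ∸ 1) * (r ∸ 1)) r≡1) (*-zeroʳ (x ∸ 1)))) z≤n
    ... | inj₂ (0<a , 0<b) =
      ≤-trans (*-monoˡ-≤ (r ∸ 1) (∸-monoˡ-≤ 1 (m≤m*n a b {{>-nonZero 0<b}}))) bound ,
      ≤-trans (*-monoˡ-≤ (r ∸ 1) (∸-monoˡ-≤ 1 (m≤n*m b a {{>-nonZero 0<a}}))) bound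

    r∸1≤L[r∸1] : r ∸ 1 ≤ L * (r ∸ 1)
    r∸1≤L[r∸1] with trivial⊎positive
    ... | inj₁ r≡1 = ≤-trans (≤-reflexive (cong (_∸ 1) r≡1)) z≤n
    ... | inj₂ (0<a , 0<b) = m≤n*m (r ∸ 1) L {{>-nonZero (*-mono-≤ 0<a 0<b)}}

    [r∸1]²≤L[r∸1]² : (r ∸ 1) ^ 2 ≤ L * (r ∸ 1) ^ 2
    [r∸1]²≤L[r∸1]² = ≤-trans (*-monoˡ-≤ ((r ∸ 1) * 1) r∸1≤L[r∸1]) (≤-reflexive (*-assoc L (r ∸ 1) ((r ∸ 1) * 1)))

    -- With X = Y = k every class has load r k and is used s k times, which is at most the number n
    -- k of edges.
    uniform-matching : ∀ k → r * k ≤ q → s ≤ n → HasMatching H (n * k)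
    uniform-matching k rk≤q s≤n = matching-from-splits {n} partition 0<r A (λ _ → k) (λ _ → k) (sum-const n k) (sum-const n k)
      (λ _ → ≤-trans (≤-reflexive (trans (sym (*-distribʳ-+ k (sumOver A (replicate s 1)) _))
        (cong (_* k) (trans (sumOver-∁ A (replicate s 1)) (sum-ones s))))) (*-monoˡ-≤ k s≤n))
      (λ _ → ≤-trans (≤-reflexive (sym (*-distribʳ-+ k a b))) rk≤q)

    -- As parts are positive, class `i` is used at most `c i` times, so `c i ≤ m` ensures `Few`.
    matching-from-loads : ∀ (c : Fin n → ℕ) {m} → (∀ i → (L ∸ 1) * (r ∸ 1) ≤ c i) → (∀ i → c i ≤ m) → (∀ i → c i ≤ q) →
      sum c ≡ r * m → HasMatching H m
    matching-from-loads c bound c≤m c≤q sum-c =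
      let X , Y , weights , sumX , sumY = equalSplits a b coprimeA c (λ i → large (bound i)) sum-c
      in matching-from-splits partition 0<r A X Y sumX sumY
        (λ i → ≤-trans (+-mono-≤ (*-monoˡ-≤ (X i) (sumOver-ones A (proj₁ partition)))
                                 (*-monoˡ-≤ (Y i) (sumOver-ones (∁ A) (proj₁ partition))))
               (≤-trans (≤-reflexive (weights i)) (c≤m i)))
        (λ i → ≤-trans (≤-reflexive (weights i)) (c≤q i))

    private e = (n * q) % r

    -- One class loses the residue of n q modulo r, all others are filled.
    near-perfect-matching : r ≤ n → e ≤ q → (L ∸ 1) * (r ∸ 1) ≤ q ∸ e → HasMatching H ((n * q) / r)
    near-perfect-matching r≤n e≤q bound = matching-from-loads c
      (λ i → ≤-trans bound (low i)) (λ i → ≤-trans (high i) q≤m) high (+-cancelʳ-≡ e _ _ (begin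
        sum {n} c + e          ≡⟨ sum-c n ⟩
        n * q                  ≡⟨ m≡m%n+[m/n]*n (n * q) r ⟩
        e + n * q / r * r      ≡⟨ +-comm e _ ⟩
        n * q / r * r + e      ≡⟨ cong (_+ e) (*-comm (n * q / r) r) ⟩
        r * (n * q / r) + e    ∎))
      where
      open ≡-Reasoning
      c : ∀ {n} → Fin n → ℕ
      c zero    = q ∸ e
      c (suc _) = q
      low : ∀ {n} (i : Fin n) → q ∸ e ≤ c i
      low zero    = ≤-refl
      low (suc _) = m∸n≤m q e
      high : ∀ {n} (i : Fin n) → c i ≤ q
      high zero    = m∸n≤m q e
      high (suc _) = ≤-refl
      -- From r ≤ n: the edges are numerous enough for a completely filled class.
      q≤m : q ≤ n * q / r
      q≤m = subst (_≤ n * q / r) (m*n/n≡m q r) (/-monoˡ-≤ r (subst (_≤ n * q) (*-comm r q) (*-monoˡ-≤ q r≤n)))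
      sum-c : ∀ n → .{{NonZero n}} → sum {n} c + e ≡ n * q
      sum-c (suc n) = trans (shuffle (q ∸ e) (sum {n} (λ _ → q)) e)
        (cong₂ _+_ (m∸n+n≡m e≤q) (sum-const n q))
        where
        shuffle : ∀ x y z → x + y + z ≡ (x + z) + y
        shuffle = solve-∀
      instance
        n≢0 : NonZero n
        n≢0 = >-nonZero (≤-trans 0<r r≤n)

    e≤r∸1 : e ≤ r ∸ 1
    e≤r∸1 = pred-mono-≤ (m%n<n (n * q) r)

    matching-leaving-residue : r ≤ n → L * (r ∸ 1) ≤ q → HasMatching H ((n * q) / r)
    matching-leaving-residue r≤n large-q = near-perfect-matching r≤n (≤-trans e≤r∸1 (≤-trans r∸1≤L[r∸1] large-q))
      -- q - e ≥ L (r - 1) - (r - 1) = (L - 1)(r - 1).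
      (≤-trans (≤-reflexive (trans (*-distribʳ-∸ (r ∸ 1) L 1) (cong (L * (r ∸ 1) ∸_) (*-identityˡ (r ∸ 1)))))
               (∸-mono large-q e≤r∸1))

    module _ {ν} (isν : IsMatchingNumber H ν) where

      perfect-conclusion : ∀ {m} → HasMatching H m → m * r ≡ n * q → HasPerfectMatching H × r * ν ≡ q * n
      perfect-conclusion (M , matching , refl) full = (M , perfect n r q σ matching full) , ≤-antisym
        (upper (proj₁ isν))
        (begin
          q * n         ≡⟨ *-comm q n ⟩
          n * q         ≡⟨ full ⟨
          length M * r  ≤⟨ *-monoˡ-≤ r (proj₂ isν M matching) ⟩
          ν * r         ≡⟨ *-comm ν r ⟩
          r * ν         ∎)
        where
        open ≤-Reasoning
        upper : HasMatching H ν → r * ν ≤ q * n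
        upper (N , matchingN , refl) = subst₂ _≤_ (*-comm (length N) r) (*-comm n q) (matching-bound n r q σ matchingN)

      leaving-conclusion : ∀ {m k} → HasMatching H m → n * q ≤ m * r + k →
        HasMatchingLeavingAtMost H k × r * ν + k ≥ q * n
      leaving-conclusion {k = k} (M , matching , refl) few = (M , matching , unmatched n r q σ matching few) , (begin
        q * n             ≡⟨ *-comm q n ⟩
        n * q             ≤⟨ few ⟩
        length M * r + k  ≤⟨ +-monoˡ-≤ k (*-monoˡ-≤ r (proj₂ isν M matching)) ⟩
        ν * r + k         ≡⟨ cong (_+ k) (*-comm ν r) ⟩
        r * ν + k         ∎)
        where open ≤-Reasoning

      part₁ : (r ∣ q × n ≥ s) ⊎ (r ∣ n × q ≥ (L ∸ 1) * (r ∸ 1)) → HasPerfectMatching H × r * ν ≡ q * n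
      part₁ (inj₁ (divides k q≡kr , s≤n)) = perfect-conclusion
        (uniform-matching k (≤-reflexive (trans (*-comm r k) (sym q≡kr))) s≤n)
        (trans (*-assoc n k r) (cong (n *_) (sym q≡kr)))
      part₁ (inj₂ (r∣n , bound)) with n ≟ 0
      -- There are no vertices, and the empty matching is perfect.
      ... | yes n≡0 = perfect-conclusion ([] , record { edges = [] ; distinct = [] ; disjoint = [] } , refl) (cong (_* q) (sym n≡0))
      ... | no  n≢0 = perfect-conclusion
        (near-perfect-matching (∣⇒≤ {{≢-nonZero n≢0}} r∣n) (subst (_≤ q) (sym e≡0) z≤n) (subst (λ x → (L ∸ 1) * (r ∸ 1) ≤ q ∸ x) (sym e≡0) bound))
        (sym (trans (m≡m%n+[m/n]*n (n * q) r) (cong (_+ n * q / r * r) e≡0)))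
        where
        e≡0 : e ≡ 0
        e≡0 = n∣m⇒m%n≡0 (n * q) r (∣m⇒∣m*n q r∣n)

      residue-conclusion : ∀ {k} → r ≤ n → L * (r ∸ 1) ≤ q → r ∸ 1 ≤ k →
        HasMatchingLeavingAtMost H k × r * ν + k ≥ q * n
      residue-conclusion {k} r≤n large-q r∸1≤k = leaving-conclusion (matching-leaving-residue r≤n large-q) (begin
        n * q                  ≡⟨ m≡m%n+[m/n]*n (n * q) r ⟩
        e + n * q / r * r      ≤⟨ +-monoˡ-≤ _ (≤-trans e≤r∸1 r∸1≤k) ⟩
        k + n * q / r * r      ≡⟨ +-comm k _ ⟩
        n * q / r * r + k      ∎)
        where open ≤-Reasoning

      part₂ : q ≥ L * (r ∸ 1) → n ≥ s → HasMatchingLeavingAtMost H (L * (r ∸ 1) ^ 2) × r * ν + L * (r ∸ 1) ^ 2 ≥ q * n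
      part₂ large-q s≤n with r ≤? n
      ... | yes r≤n = residue-conclusion r≤n large-q (≤-trans (m≤m² (r ∸ 1)) [r∸1]²≤L[r∸1]²)
      -- Each of the at most r - 1 classes loses only `q % r` vertices, again at most r - 1.
      ... | no  r≰n = leaving-conclusion (uniform-matching (q / r) rk≤q s≤n) (begin
        n * q                                    ≡⟨ cong (n *_) (m≡m%n+[m/n]*n q r) ⟩
        n * (q % r + q / r * r)                  ≡⟨ expand n (q % r) (q / r) r ⟩
        n * (q / r) * r + n * (q % r)            ≤⟨ +-monoʳ-≤ (n * (q / r) * r) (*-mono-≤ (pred-mono-≤ (≰⇒> r≰n)) (pred-mono-≤ (m%n<n q r))) ⟩
        n * (q / r) * r + (r ∸ 1) * (r ∸ 1)      ≡⟨ cong (λ x → n * (q / r) * r + (r ∸ 1) * x) (*-identityʳ (r ∸ 1)) ⟨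
        n * (q / r) * r + (r ∸ 1) ^ 2            ≤⟨ +-monoʳ-≤ (n * (q / r) * r) [r∸1]²≤L[r∸1]² ⟩
        n * (q / r) * r + L * (r ∸ 1) ^ 2        ∎)
        where
        open ≤-Reasoning
        expand : ∀ n x y r → n * (x + y * r) ≡ n * y * r + n * x
        expand = solve-∀
        rk≤q : r * (q / r) ≤ q
        rk≤q = begin
          r * (q / r)          ≡⟨ *-comm r (q / r) ⟩
          q / r * r            ≤⟨ m≤n+m _ (q % r) ⟩
          q % r + q / r * r    ≡⟨ m≡m%n+[m/n]*n q r ⟨
          q                    ∎

      -- The residue, at most r - 1 ≤ (r - 1)², is all that is lost: n ≥ r holds, and the bound on
      -- `q` implies q ≥ L (r - 1).
      part₃ : q ≥ L * (r ^ 2 ∸ 1) → n ≥ s + r → HasMatchingLeavingAtMost H ((r ∸ 1) ^ 2) × r * ν + (r ∸ 1) ^ 2 ≥ q * n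
      part₃ large-q s+r≤n = residue-conclusion (≤-trans (m≤n+m r s) s+r≤n)
        (≤-trans (*-monoʳ-≤ L (∸-monoˡ-≤ 1 (m≤m² r))) large-q) (m≤m² (r ∸ 1))

theorem3p10 :
    ∀ (n r q s : ℕ) (σ : Vec ℕ s) →
    IsPartitionOf r σ → Good r σ →
    ∀ (A B : Subset s) → Empty (A ∩ B) → A ∪ B ≡ ⊤ →
    let H = σ-hypergraph n r q σ
        a = sumOver A σ
        b = sumOver B σ
        L = lcm a b
    in
    gcd a b ≡ 1 → gcd a r ≡ 1 → gcd b r ≡ 1 →
    ∃[ ν ] (IsMatchingNumber H ν
      × ((r ∣ q × n ≥ s) ⊎ (r ∣ n × q ≥ (L ∸ 1) * (r ∸ 1)) →
           HasPerfectMatching H × r * ν ≡ q * n)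
      × (q ≥ L * (r ∸ 1) → n ≥ s →
           HasMatchingLeavingAtMost H (L * (r ∸ 1) ^ 2)
           × r * ν + L * (r ∸ 1) ^ 2 ≥ q * n)
      × (q ≥ L * (r ^ 2 ∸ 1) → s ≥ 3 → n ≥ s + r →
           HasMatchingLeavingAtMost H ((r ∸ 1) ^ 2)
           × r * ν + (r ∸ 1) ^ 2 ≥ q * n))
theorem3p10 n r q s σ partition good A B disjoint cover gcd-ab gcd-ar gcd-br
  with refl ← complement-unique A B disjoint cover
  with refl ← trans (sumOver-∁ A σ) (proj₂ partition)
  -- As gcd a b = 1, the product formula for gcd and lcm turns the lcm into the product used above.
  rewrite trans (sym (*-identityˡ (lcm (sumOver A σ) (sumOver (∁ A) σ))))
            (trans (cong (_* lcm (sumOver A σ) (sumOver (∁ A) σ)) (sym gcd-ab)) (gcd*lcm (sumOver A σ) (sumOver (∁ A) σ))) =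
  let coprimeA = gcd≡1⇒coprime gcd-ar
      coprimeB = gcd≡1⇒coprime gcd-br
      ν , isν  = matchingNumber n _ q σ (0<r n q s σ A partition coprimeA coprimeB)
  in ν , isν , part₁ n q s σ A partition coprimeA coprimeB isν ,
     part₂ n q s σ A partition coprimeA coprimeB isν ,
     λ large-q _ → part₃ n q s σ A partition coprimeA coprimeB isν large-q
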